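{- Let $T$ be a line trigraph in the class $\mathcal F$ that contains no odd prism. Then: (1) $T$ is either complete or has an even pair; (2) if $T$ is favorable, then $T$ has an even pair disjoint from its switchable component.
   Context: A trigraph $T$ consists of a finite set $V(T)$ and a map $\theta:\binom{V(T)}{2}\to\{ -1,0,1\}$. Distinct $u,v$ are strongly adjacent if $\theta(uv)=1$, strongly antiadjacent if $\theta(uv)=-1$, semiadjacent (a switchable pair) if $\theta(uv)=0$; adjacent if $\theta(uv)\in\{0,1\}$, antiadjacent if $\theta(uv)\in\{0,-1\}$. $N(v)$ is the set of vertices adjacent to $v$. $T|X$ is the restriction to $X$, $T\setminus X=T|(V(T)\setminus X)$; $T$ contains $H$ if $H$ is isomorphic to some $T|X$. A clique (strong clique) is a set of pairwise adjacent (strongly adjacent) vertices; $T$ is complete if $V(T)$ is a clique. The full realization of $T$ is the graph on $V(T)$ whose edges are the adjacent pairs. $T$ is a line trigraph if its full realization is the line graph of a bipartite graph and every clique of size at least $3$ is a strong clique. A path is a sequence $p_1,\dots,p_k$ of distinct vertices with $p_i,p_j$ adjacent when $|i-j|=1$ and antiadjacent when $|i-j|>1$; length $k-1$. A hole is a sequence $h_1,\dots,h_k$ ($k\ge5$) with cyclically consecutive vertices adjacent and other pairs antiadjacent; an antihole is an induced subtrigraph whose complement (adjacency $-\theta$) is a hole. $T$ is Berge if it has no odd hole and no odd antihole. An even pair is a strongly antiadjacent pair $\{u,v\}$ such that every path from $u$ to $v$ has even length. A prism in $T$ is an induced subtrigraph whose full realization is a prism: two disjoint triangles $\{a_1,a_2,a_3\},\{b_1,b_2,b_3\}$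 and three vertex-disjoint paths (rungs) $P_i$ from $a_i$ to $b_i$, with no other edges; it is odd if all rungs have odd length. $\Sigma(T)$ is the graph on $V(T)$ whose edges are the switchable pairs; a switchable component is a component of $\Sigma(T)$ with at least two vertices. $\mathcal F$ is the class of Berge trigraphs with at most one switchable component, having at most two edges, such that if it has one edge $xy$ then $N(x)\cap N(y)=\emptyset$ (small), and if it has two edges $vx,vy$ then $v$ is strongly antiadjacent to all vertices outside $\{v,x,y\}$, $x,y$ are strongly antiadjacent and $N(x)\cap N(y)=\{v\}$ (light). $D$ denotes the vertex set of the switchable component ($\emptyset$ if none); a pair is disjoint from the switchable component if it does not meet $D$. $T\in\mathcal F$ is favorable if $|V(T)|\ge5$, $T$ has a strongly antiadjacent pair disjoint from $D$, and, if $D=\{x,y\}$ is small, at least one of $T\setminus(D\cup N(x))$, $T\setminus(D\cup N(y))$ is not a clique. -}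

module Defs where

open import Data.Nat using (ℕ; zero; suc; _≤_; _<_)
open import Data.Fin using (Fin; toℕ; fromℕ)
open import Data.Fin.Subset using (Subset; _∈_; ∣_∣)
open import Data.Product using (Σ; _×_; _,_; proj₁; proj₂)
open import Data.Sum using (_⊎_)
open import Data.Empty using (⊥)
open import Relation.Nullary using (¬_)
open import Relation.Binary.PropositionalEquality using (_≡_; _≢_)
open import Function.Bundles using (_⇔_)
open import Function.Definitions using (Injective)

data Even : ℕ → Set
data Odd  : ℕ → Set
data Even where
  even-zero : Even zero
  even-suc  : ∀ {n} → Odd n → Even (suc n)
data Odd where
  odd-suc : ∀ {n} → Even n → Odd (suc n)

data Θ : Set where
  minus : Θ
  zer   : Θ
  plus  : Θ

-- A trigraph on vertex set Fin n.  θ is only meaningful on distinct pairs;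
-- it is symmetric.
record Trigraph : Set where
  field
    n   : ℕ
    θ   : Fin n → Fin n → Θ
    sym : ∀ u v → θ u v ≡ θ v u
open Trigraph public

V : Trigraph → Set
V T = Fin (n T)

negΘ : Θ → Θ
negΘ minus = plus
negΘ zer   = zer
negΘ plus  = minus

complement : Trigraph → Trigraph
complement T = record { n = n T ; θ = λ u v → negΘ (θ T u v) ; sym = λ u v → cong' (sym T u v) }
  where
  cong' : ∀ {a b} → a ≡ b → negΘ a ≡ negΘ b
  cong' _≡_.refl = _≡_.refl

module _ (T : Trigraph) where

  StronglyAdj : V T → V T → Set
  StronglyAdj u v = θ T u v ≡ plus

  StronglyAnti : V T → V T → Set
  StronglyAnti u v = θ T u v ≡ minus

  Semiadj : V T → V T → Set
  Semiadj u v = θ T u v ≡ zer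

  Adj : V T → V T → Set
  Adj u v = θ T u v ≢ minus

  Anti : V T → V T → Set
  Anti u v = θ T u v ≢ plus

  InN : V T → V T → Set
  InN x z = z ≢ x × Adj x z

  IsClique : (V T → Set) → Set
  IsClique X = ∀ u v → X u → X v → u ≢ v → Adj u v

  IsStrongClique : (V T → Set) → Set
  IsStrongClique X = ∀ u v → X u → X v → u ≢ v → StronglyAdj u v

  Complete : Set
  Complete = ∀ u v → u ≢ v → Adj u v

  IsPath : (m : ℕ) → (Fin (suc m) → V T) → Set
  IsPath m p = Injective _≡_ _≡_ p
             × (∀ i j → toℕ j ≡ suc (toℕ i) → Adj (p i) (p j))
             × (∀ i j → suc (toℕ i) < toℕ j → Anti (p i) (p j))

  IsEvenPair : V T → V T → Set
  IsEvenPair u v = u ≢ v × StronglyAnti u v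
                 × (∀ m (p : Fin (suc m) → V T) → IsPath m p →
                      p Data.Fin.zero ≡ u → p (fromℕ m) ≡ v → Even m)

  HasEvenPair : Set
  HasEvenPair = Σ (V T) λ u → Σ (V T) λ v → IsEvenPair u v

  CycConsec : (k : ℕ) → Fin k → Fin k → Set
  CycConsec k i j = toℕ j ≡ suc (toℕ i) ⊎ toℕ i ≡ suc (toℕ j)
                  ⊎ (toℕ i ≡ 0 × suc (toℕ j) ≡ k) ⊎ (toℕ j ≡ 0 × suc (toℕ i) ≡ k)

  IsHole : (k : ℕ) → (Fin k → V T) → Set
  IsHole k h = 5 ≤ k × Injective _≡_ _≡_ h
             × (∀ i j → i ≢ j → CycConsec k i j → Adj (h i) (h j))
             × (∀ i j → i ≢ j → ¬ CycConsec k i j → Anti (h i) (h j))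

  HasOddHole : Set
  HasOddHole = Σ ℕ λ k → Σ (Fin k → V T) λ h → IsHole k h × Odd k

  -- switchable component D: vertices incident to a switchable pair
  -- (there is at most one switchable component for T ∈ 𝓕)

  InD : V T → Set
  InD z = Σ (V T) λ w → w ≢ z × Semiadj z w

  OnlySwitchable : (V T → V T → Set) → Set
  OnlySwitchable P = ∀ u w → u ≢ w → Semiadj u w → P u w

  NoSwitchable : Set
  NoSwitchable = OnlySwitchable (λ _ _ → ⊥)

  OnlyEdge : V T → V T → Set
  OnlyEdge x y = OnlySwitchable (λ u w → (u ≡ x × w ≡ y) ⊎ (u ≡ y × w ≡ x))

  SmallComponent : Set
  SmallComponent = Σ (V T) λ x → Σ (V T) λ y →
      x ≢ y × Semiadj x y × OnlyEdge x y
    × (∀ z → ¬ (InN x z × InN y z))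

  LightComponent : Set
  LightComponent = Σ (V T) λ v → Σ (V T) λ x → Σ (V T) λ y →
      v ≢ x × v ≢ y × x ≢ y × Semiadj v x × Semiadj v y
    × OnlySwitchable (λ u w → (u ≡ v × w ≡ x) ⊎ (u ≡ x × w ≡ v)
                           ⊎ (u ≡ v × w ≡ y) ⊎ (u ≡ y × w ≡ v))
    × (∀ z → z ≢ v → z ≢ x → z ≢ y → StronglyAnti v z)
    × StronglyAnti x y
    × (∀ z → (InN x z × InN y z) ⇔ (z ≡ v))

  -- the full realization of T is the line graph of a bipartite graph H with
  -- sides Fin a and Fin b: vertices of T correspond bijectively (via e) to the
  -- edges of H, and adjacency means sharing an end.
  FullRealizationIsLineGraphOfBipartite : Set
  FullRealizationIsLineGraphOfBipartite =
    Σ ℕ λ a → Σ ℕ λ b → Σ (V T → Fin a × Fin b) λ e →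
      Injective _≡_ _≡_ e
    × (∀ u v → u ≢ v → Adj u v ⇔ (proj₁ (e u) ≡ proj₁ (e v) ⊎ proj₂ (e u) ≡ proj₂ (e v)))

  IsLineTrigraph : Set
  IsLineTrigraph = FullRealizationIsLineGraphOfBipartite
    × (∀ (X : Subset (n T)) → 3 ≤ ∣ X ∣ →
         IsClique (λ z → z ∈ X) → IsStrongClique (λ z → z ∈ X))

  -- prisms: vertices indexed by (i , a) with i : Fin 3 the rung and
  -- a : Fin (suc (m i)) the position on rung P_i (a_i at 0, b_i at m i)

  PrismIndex : (Fin 3 → ℕ) → Set
  PrismIndex m = Σ (Fin 3) λ i → Fin (suc (m i))

  PrismEdge : (m : Fin 3 → ℕ) → PrismIndex m → PrismIndex m → Set
  PrismEdge m (i , a) (j , b) =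
      (Σ (i ≡ j) λ _ → toℕ b ≡ suc (toℕ a) ⊎ toℕ a ≡ suc (toℕ b))
    ⊎ (i ≢ j × toℕ a ≡ 0 × toℕ b ≡ 0)
    ⊎ (i ≢ j × toℕ a ≡ m i × toℕ b ≡ m j)

  IsPrism : (m : Fin 3 → ℕ) → (PrismIndex m → V T) → Set
  IsPrism m f = (∀ i → 1 ≤ m i) × Injective _≡_ _≡_ f
              × (∀ s t → s ≢ t → Adj (f s) (f t) ⇔ PrismEdge m s t)

  ContainsOddPrism : Set
  ContainsOddPrism = Σ (Fin 3 → ℕ) λ m → Σ (PrismIndex m → V T) λ f →
    IsPrism m f × (∀ i → Odd (m i))

HasOddAntihole : Trigraph → Set
HasOddAntihole T = HasOddHole (complement T)

Berge : Trigraph → Set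
Berge T = ¬ HasOddHole T × ¬ HasOddAntihole T

InF : Trigraph → Set
InF T = Berge T × (NoSwitchable T ⊎ SmallComponent T ⊎ LightComponent T)

RestClique : (T : Trigraph) → V T → Set
RestClique T x = IsClique T (λ z → ¬ InD T z × ¬ InN T x z)

Favorable : Trigraph → Set
Favorable T = 5 ≤ n T
  × (Σ (V T) λ u → Σ (V T) λ v → u ≢ v × StronglyAnti T u v × ¬ InD T u × ¬ InD T v)
  × (∀ x y → x ≢ y → Semiadj T x y → OnlyEdge T x y →
       ¬ RestClique T x ⊎ ¬ RestClique T y)

{-# OPTIONS --safe #-}
module Submission where

-- Let T be the line trigraph of the bipartite graph H.  An odd prism of T is a theta of H (three internally
-- disjoint paths between two vertices) whose two branch vertices lie on the same side.  Two semiadjacent vertices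
-- have no common neighbour, so by a claw argument the paths of T between strongly antiadjacent vertices are the
-- induced paths of the full realization, and disjoint edges uv, xy of H, with u and x on the same side, form an
-- even pair iff {u,x} separates v from y and {v,y} separates u from x.
--
-- Suppose that there is no even pair, and let an arc α of a cycle of H have at least two interior vertices and be
-- separated from the rest β of the cycle by its ends p, q.  The first and third edge of α are not an even pair,
-- so there is an ear from one vertex of p ∪ α to a later vertex of α ∪ q.  Its feet lie on opposite sides, as
-- there is no same-side theta, and the arc between them is again separated from the rest of the cycle, since a
-- path crossing a theta creates a same-side theta.  Descent on the length of α shows that H has no cycle (take
-- for β a single edge).  In a forest two disjoint edges joined by a path with an odd number of edges are an even
-- pair, and either the given antiadjacent pair or a pair found on the path between them is of that kind.
--
-- To avoid the switchable component one runs the same argument with β passing through the degree-two vertices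
-- on which the switchable edges meet.  The only cycles left over are squares through the common end of the two
-- edges of a small component, and these are treated separately.

open import Defs
open import Data.Bool using (Bool; true; false; not)
import Data.Bool as Bool
open import Data.Bool.Properties using (not-¬; ¬-not; not-involutive)
open import Data.Empty using (⊥; ⊥-elim)
open import Data.Fin using (Fin; zero; suc; toℕ; fromℕ; fromℕ<; finToFun; funToFin)
import Data.Fin.Properties as Fin
open import Data.List using (List; []; _∷_; _++_; [_]; length; reverse; initLast; InitLast; _∷ʳ′_)
open import Data.List.Properties using (length-++; unfold-reverse; ++-identityʳ)
open import Data.List.Membership.Propositional using (_∈_; _∉_)
open import Data.List.Membership.Propositional.Properties using (∈-++⁻; ∈-++⁺ˡ; ∈-++⁺ʳ; ∈-∃++)
open import Data.List.Relation.Unary.Any using (here; there)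
open import Data.List.Relation.Unary.Any.Properties using (reverse⁺; reverse⁻)
open import Data.Nat using (ℕ; zero; suc; _+_; _*_; _≤_; _<_; _≤?_; _<?_; z≤n; s≤s; s≤s⁻¹)
open import Data.Nat.Properties using (≤-refl; ≤-trans; ≤-reflexive; +-mono-≤; *-monoˡ-≤; +-assoc; +-comm; +-identityʳ; m≤m+n; m≤n+m; n≤1+n; suc-injective; m≢1+n+m; <-cmp; <-irrefl; <-trans) renaming (_≟_ to _≟ℕ_)
open import Data.Nat.Solver using (module +-*-Solver)
open import Data.Product using (Σ; _×_; _,_; proj₁; proj₂; swap)
open import Data.Sum using (_⊎_; inj₁; inj₂; map₂; [_,_]′) renaming (swap to ⊎-swap)
open import Data.Sum.Properties using (inj₁-injective; inj₂-injective) renaming (≡-dec to ⊎-≡-dec)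
open import Data.Unit using (⊤; tt)
open import Data.Vec using (Vec; []; _∷_; lookup)
open import Function using (case_of_; _∘_; id)
open import Function.Bundles using (_⇔_; mk⇔; module Equivalence)
open import Function.Definitions using (Injective)
open import Relation.Binary using (DecidableEquality; Tri; tri<; tri≈; tri>)
open import Relation.Binary.PropositionalEquality using (_≡_; _≢_; _≗_; refl; trans; cong; cong₂; subst; module ≡-Reasoning) renaming (sym to ≡-sym)
open Equivalence using (to; from)
open import Relation.Nullary using (¬_; Dec; yes; no)
open import Relation.Nullary.Decidable using (True; toWitness; _⊎-dec_; _×-dec_; _→-dec_; ¬?; map′; decidable-stable)

-- Repetition-free lists, and a reflection procedure for rearranging them.

module Multiplicity {A : Set} (_≟_ : DecidableEquality A) where

  one-if : {P : Set} → Dec P → ℕ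
  one-if (yes _) = 1
  one-if (no _)  = 0

  mult : A → List A → ℕ
  mult x []       = 0
  mult x (y ∷ ys) = one-if (x ≟ y) + mult x ys

  -- Bounding multiplicities makes the property insensitive to order and monotone in occurrence
  -- counts, so that regrouping the pieces of a cycle reduces to comparing counts.
  record Nodup (xs : List A) : Set where
    constructor nodup
    field mult≤1 : ∀ x → mult x xs ≤ 1
  open Nodup public

  mult-++ : ∀ x xs ys → mult x (xs ++ ys) ≡ mult x xs + mult x ys
  mult-++ x []       ys = refl
  mult-++ x (y ∷ xs) ys =
    trans (cong (one-if (x ≟ y) +_) (mult-++ x xs ys)) (≡-sym (+-assoc (one-if (x ≟ y)) _ _))

  mult-reverse : ∀ x xs → mult x (reverse xs) ≡ mult x xs
  mult-reverse x []       = refl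
  mult-reverse x (y ∷ xs) = begin
    mult x (reverse (y ∷ xs))              ≡⟨ cong (mult x) (unfold-reverse y xs) ⟩
    mult x (reverse xs ++ [ y ])           ≡⟨ mult-++ x (reverse xs) [ y ] ⟩
    mult x (reverse xs) + mult x [ y ]     ≡⟨ cong₂ _+_ (mult-reverse x xs) (+-identityʳ _) ⟩
    mult x xs + one-if (x ≟ y)             ≡⟨ +-comm (mult x xs) _ ⟩
    mult x (y ∷ xs)                        ∎
    where open ≡-Reasoning

  ∈⇒1≤mult : ∀ {x xs} → x ∈ xs → 1 ≤ mult x xs
  ∈⇒1≤mult {x} {y ∷ xs} (here x≡y) with x ≟ y
  ... | yes _  = s≤s z≤n
  ... | no x≢y = ⊥-elim (x≢y x≡y)
  ∈⇒1≤mult {x} {y ∷ xs} (there x∈xs) = ≤-trans (∈⇒1≤mult x∈xs) (m≤n+m _ (one-if (x ≟ y)))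

  ∉⇒mult≡0 : ∀ {x xs} → x ∉ xs → mult x xs ≡ 0
  ∉⇒mult≡0 {x} {[]}     _    = refl
  ∉⇒mult≡0 {x} {y ∷ xs} x∉ with x ≟ y
  ... | yes x≡y = ⊥-elim (x∉ (here x≡y))
  ... | no _    = ∉⇒mult≡0 (λ x∈ → x∉ (there x∈))

  open import Data.List.Membership.DecPropositional _≟_ public using (_∈?_)

  nodup-++ : ∀ {xs ys} → Nodup xs → Nodup ys → (∀ {x} → x ∈ xs → x ∉ ys) → Nodup (xs ++ ys)
  nodup-++ {xs} {ys} nx ny dis .mult≤1 x rewrite mult-++ x xs ys with x ∈? xs
  ... | yes x∈ rewrite ∉⇒mult≡0 (dis x∈) | +-identityʳ (mult x xs) = mult≤1 nx x
  ... | no x∉  rewrite ∉⇒mult≡0 x∉ = mult≤1 ny x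

  nodup-∷ : ∀ {x xs} → x ∉ xs → Nodup xs → Nodup (x ∷ xs)
  nodup-∷ {x} x∉ n = nodup-++ {x ∷ []} (nodup one) n (λ { (here refl) → x∉ })
    where
    one : ∀ y → mult y (x ∷ []) ≤ 1
    one y with y ≟ x
    ... | yes _ = ≤-refl
    ... | no _  = z≤n

  nodup-disjoint : ∀ xs {ys x} → Nodup (xs ++ ys) → x ∈ xs → x ∉ ys
  nodup-disjoint xs {ys} {x} n x∈ x∈′ with ≤-trans (+-mono-≤ (∈⇒1≤mult x∈) (∈⇒1≤mult x∈′))
                                               (≤-trans (≤-reflexive (≡-sym (mult-++ x xs ys))) (mult≤1 n x))
  ... | s≤s ()

  nodup-head : ∀ {x xs} → Nodup (x ∷ xs) → x ∉ xs
  nodup-head {x} n = nodup-disjoint (x ∷ []) n (here refl)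

  data Expr (n : ℕ) : Set where
    var : Fin n → Expr n
    _⊕_ : Expr n → Expr n → Expr n
    rev : Expr n → Expr n

  infixr 5 _⊕_

  ⟦_⟧ : ∀ {n} → Expr n → Vec (List A) n → List A
  ⟦ var i ⟧ ρ = lookup ρ i
  ⟦ s ⊕ t ⟧ ρ = ⟦ s ⟧ ρ ++ ⟦ t ⟧ ρ
  ⟦ rev t ⟧ ρ = reverse (⟦ t ⟧ ρ)

  δ : ∀ {n} → Fin n → Fin n → ℕ
  δ zero    zero    = 1
  δ zero    (suc _) = 0
  δ (suc _) zero    = 0
  δ (suc i) (suc j) = δ i j

  occ : ∀ {n} → Expr n → Fin n → ℕ
  occ (var i) j = δ i j
  occ (s ⊕ t) j = occ s j + occ t j
  occ (rev t) j = occ t j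

  weighted : ∀ {n} → A → (Fin n → ℕ) → Vec (List A) n → ℕ
  weighted x c []      = 0
  weighted x c (l ∷ ρ) = c zero * mult x l + weighted x (λ i → c (suc i)) ρ

  weighted-mono : ∀ {n} x {c d : Fin n → ℕ} (ρ : Vec (List A) n) →
                  (∀ i → c i ≤ d i) → weighted x c ρ ≤ weighted x d ρ
  weighted-mono x []      _   = z≤n
  weighted-mono x (l ∷ ρ) c≤d =
    +-mono-≤ (*-monoˡ-≤ (mult x l) (c≤d zero)) (weighted-mono x ρ (λ i → c≤d (suc i)))

  weighted-0 : ∀ {n} x (ρ : Vec (List A) n) → weighted x (λ _ → 0) ρ ≡ 0
  weighted-0 x []      = refl
  weighted-0 x (l ∷ ρ) = weighted-0 x ρ

  weighted-+ : ∀ {n} x (c d : Fin n → ℕ) (ρ : Vec (List A) n) →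
               weighted x (λ i → c i + d i) ρ ≡ weighted x c ρ + weighted x d ρ
  weighted-+ x c d []      = refl
  weighted-+ x c d (l ∷ ρ) =
    trans (cong ((c zero + d zero) * mult x l +_) (weighted-+ x _ _ ρ))
      (solve 5 (λ c d m u v → (c :+ d) :* m :+ (u :+ v) := (c :* m :+ u) :+ (d :* m :+ v)) refl
        (c zero) (d zero) (mult x l) _ _)
    where open +-*-Solver

  weighted-δ : ∀ {n} x (i : Fin n) (ρ : Vec (List A) n) → weighted x (δ i) ρ ≡ mult x (lookup ρ i)
  weighted-δ x zero    (l ∷ ρ) = trans (cong₂ _+_ (+-identityʳ _) (weighted-0 x ρ)) (+-identityʳ _)
  weighted-δ x (suc i) (l ∷ ρ) = weighted-δ x i ρ

  -- Concatenation adds multiplicities and reversal preserves them, so the multiplicity in an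
  -- expression is a linear form in those in the atoms.
  mult-⟦⟧ : ∀ {n} x (t : Expr n) ρ → mult x (⟦ t ⟧ ρ) ≡ weighted x (occ t) ρ
  mult-⟦⟧ x (var i) ρ = ≡-sym (weighted-δ x i ρ)
  mult-⟦⟧ x (s ⊕ t) ρ = trans (mult-++ x (⟦ s ⟧ ρ) _)
    (trans (cong₂ _+_ (mult-⟦⟧ x s ρ) (mult-⟦⟧ x t ρ)) (≡-sym (weighted-+ x (occ s) (occ t) ρ)))
  mult-⟦⟧ x (rev t) ρ = trans (mult-reverse x (⟦ t ⟧ ρ)) (mult-⟦⟧ x t ρ)

  -- Reflection: both lists are written as expressions in the atoms ρ, and their occurrence counts are compared.
  nodup-⊆ : ∀ {n} (ρ : Vec (List A) n) (s t : Expr n) →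
            {True (Fin.all? (λ i → occ s i ≤? occ t i))} → Nodup (⟦ t ⟧ ρ) → Nodup (⟦ s ⟧ ρ)
  nodup-⊆ ρ s t {s≤t} nt .mult≤1 x = ≤-trans
    (≤-trans (≤-reflexive (mult-⟦⟧ x s ρ)) (weighted-mono x ρ (toWitness s≤t)))
    (≤-trans (≤-reflexive (≡-sym (mult-⟦⟧ x t ρ))) (mult≤1 nt x))

  v0 : ∀ {n} → Expr (1 + n)
  v0 = var zero
  v1 : ∀ {n} → Expr (2 + n)
  v1 = var (suc zero)
  v2 : ∀ {n} → Expr (3 + n)
  v2 = var (suc (suc zero))
  v3 : ∀ {n} → Expr (4 + n)
  v3 = var (suc (suc (suc zero)))
  v4 : ∀ {n} → Expr (5 + n)
  v4 = var (suc (suc (suc (suc zero))))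
  v5 : ∀ {n} → Expr (6 + n)
  v5 = var (suc (suc (suc (suc (suc zero)))))
  v6 : ∀ {n} → Expr (7 + n)
  v6 = var (suc (suc (suc (suc (suc (suc zero))))))
  v7 : ∀ {n} → Expr (8 + n)
  v7 = var (suc (suc (suc (suc (suc (suc (suc zero)))))))
  v8 : ∀ {n} → Expr (9 + n)
  v8 = var (suc (suc (suc (suc (suc (suc (suc (suc zero))))))))
  v9 : ∀ {n} → Expr (10 + n)
  v9 = var (suc (suc (suc (suc (suc (suc (suc (suc (suc zero)))))))))

-- Walks, ears and barriers in a graph.

module Walks {W : Set} (_≟_ : DecidableEquality W) (E : W → W → Set) (E-sym : ∀ {u v} → E u v → E v u) where

  open Multiplicity _≟_

  -- The list consists of the interior vertices.
  data Walk : W → List W → W → Set where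
    edge : ∀ {a b} → E a b → Walk a [] b
    step : ∀ {a c l b} → E a c → Walk c l b → Walk a (c ∷ l) b

  walk-++ : ∀ {a l c l′ b} → Walk a l c → Walk c l′ b → Walk a (l ++ c ∷ l′) b
  walk-++ (edge e)   w′ = step e w′
  walk-++ (step e w) w′ = step e (walk-++ w w′)

  walk-reverse : ∀ {a l b} → Walk a l b → Walk b (reverse l) a
  walk-reverse (edge e) = edge (E-sym e)
  walk-reverse {a} {c ∷ l} {b} (step e w) =
    subst (λ k → Walk b k a) (≡-sym (unfold-reverse c l)) (walk-++ (walk-reverse w) (edge (E-sym e)))

  walk-split : ∀ {a} l {c l′ b} → Walk a (l ++ c ∷ l′) b → Walk a l c × Walk c l′ b
  walk-split []      (step e w) = edge e , w
  walk-split (x ∷ l) (step e w) = let w₁ , w₂ = walk-split l w in step e w₁ , w₂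

  hd : List W → W → W
  hd []      b = b
  hd (c ∷ _) b = c

  walk-hd : ∀ {a l b} → Walk a l b → E a (hd l b)
  walk-hd (edge e)   = e
  walk-hd (step e _) = e

  -- When the vertex about to be prepended already lies on the simplified tail, the tail is cut back
  -- to that occurrence. Only repetitions in the interior are removed; in an ear the ends are kept
  -- off the interior by `P` and `Q`.
  simplify : ∀ {a l b} → Walk a l b → Σ (List W) λ k → Walk a k b × Nodup k × (∀ {x} → x ∈ k → x ∈ l)
  simplify (edge e) = [] , edge e , nodup (λ _ → z≤n) , λ ()
  simplify {a} {c ∷ l} {b} (step e w) with simplify w
  ... | k , w′ , nk , k⊆l with c ∈? k
  ... | no c∉k = c ∷ k , step e w′ , nodup-∷ c∉k nk , λ { (here eq) → here eq ; (there x∈) → there (k⊆l x∈) }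
  ... | yes c∈k with ∈-∃++ c∈k
  ... | k₁ , k₂ , refl = c ∷ k₂ , step e (proj₂ (walk-split k₁ w′))
    , nodup-⊆ (k₁ ∷ (c ∷ []) ∷ k₂ ∷ []) (v1 ⊕ v2) (v0 ⊕ v1 ⊕ v2) nk
    , λ { (here eq) → here eq ; (there x∈) → there (k⊆l (∈-++⁺ʳ k₁ (there x∈))) }

  -- Here `l` and `v` are the interior and the end of the walk from which the ear is cut. The fields
  -- `k⊆l` and `s′∈l` pass on to the ear what the walk avoids, including a prospective foot.
  record Ear (P Q : W → Set) (l : List W) (v : W) : Set where
    constructor ear
    field
      {s s′}   : W
      {k}      : List W
      start    : P s
      end      : Q s′
      walk     : Walk s k s′
      simple   : Nodup k
      ∉P       : ∀ {x} → x ∈ k → ¬ P x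
      ∉Q       : ∀ {x} → x ∈ k → ¬ Q x
      k⊆l      : ∀ {x} → x ∈ k → x ∈ l
      s′∈l     : s′ ≡ v ⊎ s′ ∈ l

  module _ {P Q : W → Set} (P? : ∀ x → Dec (P x)) (Q? : ∀ x → Dec (Q x)) where

    private
      Hit : W → List W → W → Set
      Hit c l v = Σ W λ s′ → Σ (List W) λ k → Q s′ × Walk c k s′ × (∀ {x} → x ∈ k → ¬ P x × ¬ Q x)
                    × (∀ {x} → x ∈ k → x ∈ l) × (s′ ≡ v ⊎ s′ ∈ l)

      fromHit : ∀ {c l v} → P c → Hit c l v → Ear P Q l v
      fromHit Pc (s′ , k , Qs′ , w , av , k⊆l , s′∈) with simplify w
      ... | k′ , w′ , nk′ , k′⊆k = ear Pc Qs′ w′ nk′ (λ x∈ → proj₁ (av (k′⊆k x∈)))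
                                       (λ x∈ → proj₂ (av (k′⊆k x∈))) (λ x∈ → k⊆l (k′⊆k x∈)) s′∈

      -- The recursion works back from the end of the walk. A vertex of `Q` restarts the pending
      -- stretch `Hit`; a vertex of `P` in front of the stretch completes an ear.
      scan : ∀ {c l v} → Walk c l v → Q v → Ear P Q l v ⊎ Hit c l v
      scan {v = v} (edge e) Qv = inj₂ (v , [] , Qv , edge e , (λ ()) , (λ ()) , inj₁ refl)
      scan {l = d ∷ l} {v} (step e w) Qv with Q? d
      ... | yes Qd = inj₂ (d , [] , Qd , edge e , (λ ()) , (λ ()) , inj₂ (here refl))
      ... | no ¬Qd with scan w Qv
      ... | inj₁ (ear a b c d′ f g h i) =
              inj₁ (ear a b c d′ f g (λ x∈ → there (h x∈)) (map₂ there i))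
      ... | inj₂ hit@(s′ , k , Qs′ , w′ , av , k⊆l , s′∈) with P? d
      ...   | yes Pd with fromHit Pd hit
      ...     | ear a b c d′ f g h i =
              inj₁ (ear a b c d′ f g (λ x∈ → there (h x∈)) (map₂ there i))
      scan {l = d ∷ l} {v} (step e w) Qv | no ¬Qd | inj₂ (s′ , k , Qs′ , w′ , av , k⊆l , s′∈) | no ¬Pd =
        inj₂ (s′ , d ∷ k , Qs′ , step e w′ , (λ { (here refl) → ¬Pd , ¬Qd ; (there x∈) → av x∈ })
          , (λ { (here eq) → here eq ; (there x∈) → there (k⊆l x∈) }) , map₂ there s′∈)

    -- The stretch of a walk from its last visit to P before its first subsequent visit to Q.
    findEar : ∀ {u l v} → Walk u l v → P u → Q v → Ear P Q l v
    findEar w Pu Qv with scan w Qv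
    ... | inj₁ e   = e
    ... | inj₂ hit = fromHit Pu hit

  findPath : ∀ {u l v} → Walk u l v → u ≢ v →
             Σ (List W) λ k → Walk u k v × Nodup (u ∷ v ∷ k) × (∀ {x} → x ∈ k → x ∈ l)
  findPath {u} {l} {v} w u≢v with findEar (_≟ u) (_≟ v) w refl refl
  ... | ear {k = k} refl refl w′ nk ∉u ∉v k⊆l _ =
    k , w′ , nodup-∷ (λ { (here eq) → u≢v eq ; (there u∈) → ∉u u∈ refl }) (nodup-∷ (λ v∈ → ∉v v∈ refl) nk) , k⊆l

  -- On the edge by which the walk first enters `S`, the outer vertex is `p` or `q` by `sep`; but it
  -- is `s` or an interior vertex of the walk.
  barrier : {S : W → Set} → (∀ x → Dec (S x)) → ∀ {p q} →
            (∀ {x t} → S t → E t x → S x ⊎ x ≡ p ⊎ x ≡ q) →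
            ∀ {s k t} → Walk s k t → S t → ¬ S s → s ≢ p → s ≢ q → p ∉ k → q ∉ k → ⊥
  barrier S? sep (edge e) St ¬Ss s≢p s≢q _ _ with sep St (E-sym e)
  ... | inj₁ Ss          = ¬Ss Ss
  ... | inj₂ (inj₁ s≡p)  = s≢p s≡p
  ... | inj₂ (inj₂ s≡q)  = s≢q s≡q
  barrier S? sep (step {c = c} e w) St ¬Ss s≢p s≢q p∉ q∉ with S? c
  ... | yes Sc = barrier S? sep (edge e) Sc ¬Ss s≢p s≢q (λ ()) (λ ())
  ... | no ¬Sc = barrier S? sep w St ¬Sc (λ { refl → p∉ (here refl) }) (λ { refl → q∉ (here refl) })
                   (λ p∈ → p∉ (there p∈)) (λ q∈ → q∉ (there q∈))

  rotate : ∀ {c α w} → Walk c α c → Nodup (c ∷ α) → 2 ≤ length α → w ∈ c ∷ α →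
           Σ (List W) λ α′ → Walk w α′ w × Nodup (w ∷ α′) × 2 ≤ length α′ × (∀ {x} → x ∈ c ∷ α → x ∈ w ∷ α′)
  rotate {α = α} w n len (here refl) = α , w , n , len , λ x∈ → x∈
  rotate {c} {α} {t} w n len (there t∈) with ∈-∃++ t∈
  ... | α₁ , α₂ , refl =
      α₂ ++ c ∷ α₁ , walk-++ (proj₂ ws) (proj₁ ws)
    , nodup-⊆ ((c ∷ []) ∷ α₁ ∷ (t ∷ []) ∷ α₂ ∷ []) (v2 ⊕ v3 ⊕ v0 ⊕ v1) (v0 ⊕ v1 ⊕ v2 ⊕ v3) n
    , subst (2 ≤_) (lengths α₁ α₂) len , mem
    where
    ws = walk-split α₁ w
    lengths : ∀ xs ys → length (xs ++ t ∷ ys) ≡ length (ys ++ c ∷ xs)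
    lengths xs ys rewrite length-++ xs {t ∷ ys} | length-++ ys {c ∷ xs} =
      solve 2 (λ a b → a :+ (con 1 :+ b) := b :+ (con 1 :+ a)) refl (length xs) (length ys)
      where open +-*-Solver
    mem : ∀ {x} → x ∈ c ∷ α₁ ++ t ∷ α₂ → x ∈ t ∷ α₂ ++ c ∷ α₁
    mem (here refl) = there (∈-++⁺ʳ α₂ (here refl))
    mem (there x∈) with ∈-++⁻ α₁ x∈
    ... | inj₁ x∈₁         = there (∈-++⁺ʳ α₂ (there x∈₁))
    ... | inj₂ (here refl) = here refl
    ... | inj₂ (there x∈₂) = there (∈-++⁺ˡ x∈₂)

-- Bipartite graphs: parity of walks.

module Bipartite {W : Set} (_≟_ : DecidableEquality W) (E : W → W → Set) (E-sym : ∀ {u v} → E u v → E v u)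
  (side : W → Bool) (E-side : ∀ {u v} → E u v → side v ≡ not (side u)) where

  open Multiplicity _≟_
  open Walks _≟_ E E-sym

  two-steps : ∀ {u v w} → E u v → E v w → side u ≡ side w
  two-steps {u} e f = ≡-sym (trans (E-side f) (trans (cong not (E-side e)) (not-involutive (side u))))

  opposite : ∀ {u v} → E u v → side u ≢ side v
  opposite e eq = not-¬ (≡-sym eq) (E-side e)

  across : ∀ {u v x y} → E u v → E x y → side u ≡ side x → side v ≡ side y
  across e f eq = trans (E-side e) (trans (cong not eq) (≡-sym (E-side f)))

  opposite-side : ∀ {a b c} → side a ≢ side b → side c ≢ side a → side c ≡ side b
  opposite-side a≢b c≢a = trans (¬-not c≢a) (≡-sym (¬-not (λ eq → a≢b (≡-sym eq))))

  mutual
    -- A walk has one interior vertex fewer than it has edges, so ends on the same side correspond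
    -- to an odd `length l`.
    walk-odd : ∀ {a l b} → Walk a l b → side a ≡ side b → Odd (length l)
    walk-odd (edge e)   eq = ⊥-elim (opposite e eq)
    walk-odd (step e w) eq = odd-suc (walk-even w (λ eq′ → opposite e (trans eq (≡-sym eq′))))

    walk-even : ∀ {a l b} → Walk a l b → side a ≢ side b → Even (length l)
    walk-even (edge e)   _  = even-zero
    walk-even (step e w) ne = even-suc (walk-odd w (opposite-side ne (λ eq → opposite e (≡-sym eq))))

  odd-interior : ∀ {a l b} → Odd (length l) → Walk a l b → side a ≡ side b
  even-interior : ∀ {a l b} → Even (length l) → Walk a l b → side b ≡ not (side a)
  odd-interior {a} (odd-suc ev) (step e w) =
    ≡-sym (trans (even-interior ev w) (trans (cong not (E-side e)) (not-involutive (side a))))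
  even-interior _            (edge e)   = E-side e
  even-interior (even-suc o) (step e w) = trans (≡-sym (odd-interior o w)) (E-side e)

  -- Branch vertices on the same side make all three interiors odd, and the number of interior
  -- vertices of a path is the length of the corresponding rung in the line graph.
  NoTheta : Set
  NoTheta = ∀ {a b l₁ l₂ l₃} → side a ≡ side b → Walk a l₁ b → Walk a l₂ b → Walk a l₃ b →
            Nodup (a ∷ b ∷ l₁ ++ l₂ ++ l₃) → ⊥

  -- Separation without same-side thetas, and the descent on arcs of a cycle.

  module ThetaFree (noTheta : NoTheta) where

    private
      -- The theta has branch vertices `a` and `s`; its paths run directly along `w₁`, through `s′`
      -- and `wk`, and through `b`.
      crossing-same : ∀ {a b s s′ m₁ m₁′ m₂ l₃ k} → side s ≡ side a →
        Walk a m₁ s → Walk s m₁′ b → Walk a m₂ s′ → Walk a l₃ b → Walk s k s′ →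
        Nodup (a ∷ b ∷ s ∷ s′ ∷ m₁ ++ m₁′ ++ m₂ ++ l₃ ++ k) → ⊥
      crossing-same {a} {b} {s} {s′} {m₁} {m₁′} {m₂} {l₃} {k} eq w₁ w₁′ w₂ w₃ wk n =
        noTheta (≡-sym eq) w₁ (walk-++ w₂ (walk-reverse wk)) (walk-++ w₃ (walk-reverse w₁′))
          (nodup-⊆ ([ a ] ∷ [ b ] ∷ [ s ] ∷ [ s′ ] ∷ m₁ ∷ m₁′ ∷ m₂ ∷ l₃ ∷ k ∷ [])
            (v0 ⊕ v2 ⊕ v4 ⊕ (v6 ⊕ v3 ⊕ rev v8) ⊕ (v7 ⊕ v1 ⊕ rev v5))
            (v0 ⊕ v1 ⊕ v2 ⊕ v3 ⊕ v4 ⊕ v5 ⊕ v6 ⊕ v7 ⊕ v8) n)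

    -- s lies on the side of a or of b, hence forms a same-side theta with that end.
    crossing : ∀ {a b s s′ m₁ m₁′ m₂ m₂′ l₃ k} → side a ≢ side b →
      Walk a m₁ s → Walk s m₁′ b → Walk a m₂ s′ → Walk s′ m₂′ b → Walk a l₃ b → Walk s k s′ →
      Nodup (a ∷ b ∷ s ∷ s′ ∷ m₁ ++ m₁′ ++ m₂ ++ m₂′ ++ l₃ ++ k) → ⊥
    crossing {a} {b} {s} {s′} {m₁} {m₁′} {m₂} {m₂′} {l₃} {k} a≢b w₁ w₁′ w₂ w₂′ w₃ wk n
      with side s Bool.≟ side a
    ... | yes eq = crossing-same eq w₁ w₁′ w₂ w₃ wk
          (nodup-⊆ ρ (v0 ⊕ v1 ⊕ v2 ⊕ v3 ⊕ v4 ⊕ v5 ⊕ v6 ⊕ v8 ⊕ v9) all n)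
      where
      ρ   = [ a ] ∷ [ b ] ∷ [ s ] ∷ [ s′ ] ∷ m₁ ∷ m₁′ ∷ m₂ ∷ m₂′ ∷ l₃ ∷ k ∷ []
      all = v0 ⊕ v1 ⊕ v2 ⊕ v3 ⊕ v4 ⊕ v5 ⊕ v6 ⊕ v7 ⊕ v8 ⊕ v9
    ... | no ne = crossing-same (opposite-side a≢b ne)
          (walk-reverse w₁′) (walk-reverse w₁) (walk-reverse w₂′) (walk-reverse w₃) wk
          (nodup-⊆ ρ (v1 ⊕ v0 ⊕ v2 ⊕ v3 ⊕ rev v5 ⊕ rev v4 ⊕ rev v7 ⊕ rev v8 ⊕ v9) all n)
      where
      ρ   = [ a ] ∷ [ b ] ∷ [ s ] ∷ [ s′ ] ∷ m₁ ∷ m₁′ ∷ m₂ ∷ m₂′ ∷ l₃ ∷ k ∷ []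
      all = v0 ⊕ v1 ⊕ v2 ⊕ v3 ⊕ v4 ⊕ v5 ⊕ v6 ⊕ v7 ⊕ v8 ⊕ v9

    Separates : W → W → List W → List W → Set
    Separates p q α β = ∀ {s k s′} → s ∈ α → s′ ∈ β → Walk s k s′ → p ∉ k → q ∉ k → ⊥

    -- A walk from `α` to `β` that avoids both branch vertices contains a path from `α` to another
    -- arc of the theta, which `crossing` excludes.
    theta-separates : ∀ {c₁ c₂ α β κ} → side c₁ ≢ side c₂ →
      Walk c₁ α c₂ → Walk c₂ β c₁ → Walk c₁ κ c₂ → Nodup (c₁ ∷ c₂ ∷ α ++ β ++ κ) → Separates c₁ c₂ α β
    theta-separates {c₁} {c₂} {α} {β} {κ} c₁≢c₂ wα wβ wκ n s∈ s′∈ w c₁∉ c₂∉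
      -- The walk may meet `κ` before `β`. Counting `κ` among the targets keeps the interior of the
      -- ear off the whole theta.
      with findEar {_∈ α} {_∈ (β ++ κ)} (_∈? α) (_∈? (β ++ κ)) w s∈ (∈-++⁺ˡ s′∈)
    ... | ear {t} {t′} {k} t∈ t′∈ wk nk ∉α ∉βκ k⊆l _ = go
      where
      disjoint : ∀ {x} → x ∈ c₁ ∷ c₂ ∷ α ++ β ++ κ → x ∉ k
      disjoint (here refl) x∈k = c₁∉ (k⊆l x∈k)
      disjoint (there (here refl)) x∈k = c₂∉ (k⊆l x∈k)
      disjoint (there (there x∈)) x∈k with ∈-++⁻ α x∈
      ... | inj₁ x∈α  = ∉α x∈k x∈α
      ... | inj₂ x∈βκ = ∉βκ x∈k x∈βκ
      n′ : Nodup ((c₁ ∷ c₂ ∷ α ++ β ++ κ) ++ k)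
      n′ = nodup-++ {c₁ ∷ c₂ ∷ α ++ β ++ κ} n nk disjoint
      go : ⊥
      go with ∈-∃++ t∈ | ∈-++⁻ β t′∈
      ... | α₁ , α₂ , refl | inj₁ t′∈β with ∈-∃++ t′∈β
      ...   | β₁ , β₂ , refl =
        crossing c₁≢c₂ (proj₁ (walk-split α₁ wα)) (proj₂ (walk-split α₁ wα))
          (walk-reverse (proj₂ (walk-split β₁ wβ))) (walk-reverse (proj₁ (walk-split β₁ wβ))) wκ wk
          (nodup-⊆ ([ c₁ ] ∷ [ c₂ ] ∷ [ t ] ∷ [ t′ ] ∷ α₁ ∷ α₂ ∷ β₁ ∷ β₂ ∷ κ ∷ k ∷ [])
            (v0 ⊕ v1 ⊕ v2 ⊕ v3 ⊕ v4 ⊕ v5 ⊕ rev v7 ⊕ rev v6 ⊕ v8 ⊕ v9)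
            ((v0 ⊕ v1 ⊕ (v4 ⊕ v2 ⊕ v5) ⊕ (v6 ⊕ v3 ⊕ v7) ⊕ v8) ⊕ v9) n′)
      go | α₁ , α₂ , refl | inj₂ t′∈κ with ∈-∃++ t′∈κ
      ...   | κ₁ , κ₂ , refl =
        crossing c₁≢c₂ (proj₁ (walk-split α₁ wα)) (proj₂ (walk-split α₁ wα))
          (proj₁ (walk-split κ₁ wκ)) (proj₂ (walk-split κ₁ wκ)) (walk-reverse wβ) wk
          (nodup-⊆ ([ c₁ ] ∷ [ c₂ ] ∷ [ t ] ∷ [ t′ ] ∷ α₁ ∷ α₂ ∷ κ₁ ∷ κ₂ ∷ β ∷ k ∷ [])
            (v0 ⊕ v1 ⊕ v2 ⊕ v3 ⊕ v4 ⊕ v5 ⊕ v6 ⊕ v7 ⊕ rev v8 ⊕ v9)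
            ((v0 ⊕ v1 ⊕ (v4 ⊕ v2 ⊕ v5) ⊕ v8 ⊕ (v6 ⊕ v3 ⊕ v7)) ⊕ v9) n′)

    -- The two walks excluded in noGood are exactly what prevents uv and xy from being an even pair of the line graph.
    -- Av holds at the vertices other than the degree-two vertices on which the switchable edges meet.
    module NoGoodPair (Av : W → Set)
      (noGood : ∀ {u v x y} → E u v → E x y → side u ≡ side x → u ≢ x → v ≢ y → Av u → Av v → Av x → Av y →
                (∀ {k} → Walk v k y → u ∉ k → x ∉ k → ⊥) → (∀ {k} → Walk u k x → v ∉ k → y ∉ k → ⊥) → ⊥)
      where

      -- The measure `n` bounds `α` alone, and only `p`, `q` and `α` must satisfy `Av`. The arc `β`
      -- may thus grow during the descent and may contain the vertices to be avoided.
      Descent : ℕ → Set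
      Descent n = ∀ {p q α β} → length α ≤ n → 2 ≤ length α → Walk p α q → Walk q β p →
        Nodup (p ∷ q ∷ α ++ β) → (∀ {x} → x ∈ p ∷ q ∷ α → Av x) → Separates p q α β → ⊥

      -- Feet on the same side form a theta with the two arcs of the cycle. Feet on opposite sides
      -- inherit the separation from `theta-separates`, and parity raises the length of a nonempty
      -- `α` to at least two.
      fromEar : ∀ {n} → Descent n → ∀ {c₁ c₂ α β κ} → length α ≤ n → 1 ≤ length α →
        Walk c₁ α c₂ → Walk c₂ β c₁ → Walk c₁ κ c₂ → Nodup (c₁ ∷ c₂ ∷ α ++ β ++ κ) →
        (∀ {x} → x ∈ c₁ ∷ c₂ ∷ α → Av x) → ⊥
      fromEar IH {c₁} {c₂} {α} {β} {κ} len len₁ wα wβ wκ n av with side c₁ Bool.≟ side c₂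
      ... | yes eq = noTheta eq wα (walk-reverse wβ) wκ
              (nodup-⊆ ([ c₁ ] ∷ [ c₂ ] ∷ α ∷ β ∷ κ ∷ []) (v0 ⊕ v1 ⊕ v2 ⊕ rev v3 ⊕ v4) (v0 ⊕ v1 ⊕ v2 ⊕ v3 ⊕ v4) n)
      ... | no ne = IH len (two-long wα len₁) wα wβ
              (nodup-⊆ ([ c₁ ] ∷ [ c₂ ] ∷ α ∷ β ∷ κ ∷ []) (v0 ⊕ v1 ⊕ v2 ⊕ v3) (v0 ⊕ v1 ⊕ v2 ⊕ v3 ⊕ v4) n)
              av (theta-separates ne wα wβ wκ n)
        where
        two-long : ∀ {l} → Walk c₁ l c₂ → 1 ≤ length l → 2 ≤ length l
        two-long (step e (edge f))   _ = ⊥-elim (ne (two-steps e f))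
        two-long (step e (step f w)) _ = s≤s (s≤s z≤n)

      -- A failure of the pair (p y₁, y₂ y₃) yields an ear on the cycle, starting at y₁ or y₂,
      -- whose feet cut off a shorter part of α.
      descend : ∀ n → Descent n
      descend zero {α = _ ∷ _} () _
      descend (suc n) (s≤s _) (s≤s ()) (step _ (edge _))
      descend (suc n) {p} {q} {y₁ ∷ y₂ ∷ l} {β} (s≤s len) _ (step e₁ (step e₂ w)) wβ nd av sep =
        noGood e₁ (walk-hd w) (two-steps e₁ e₂) p≢y₂ y₁≢y₃ (av (here refl)) (av (there (there (here refl))))
          (av (there (there (there (here refl))))) (hd-Av l λ x∈ → av (there x∈)) bad₁ bad₂
        where
        ρ = [ p ] ∷ [ q ] ∷ [ y₁ ] ∷ [ y₂ ] ∷ l ∷ β ∷ []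
        all : Expr 6
        all = v0 ⊕ v1 ⊕ (v2 ⊕ v3 ⊕ v4) ⊕ v5
        -- If `α` ends at `y₂`, the third edge of the arc leads to `q`.
        y₃ = hd l q
        hd∈ : ∀ l {zs} → hd l q ∈ l ++ q ∷ zs
        hd∈ []      = here refl
        hd∈ (_ ∷ _) = here refl
        hd-Av : ∀ l → (∀ {x} → x ∈ q ∷ y₁ ∷ y₂ ∷ l → Av x) → Av (hd l q)
        hd-Av []      av = av (here refl)
        hd-Av (_ ∷ _) av = av (there (there (there (here refl))))
        p≢y₂ : p ≢ y₂
        p≢y₂ eq = nodup-head (nodup-⊆ ρ (v0 ⊕ v3) all nd) (here eq)
        y₁∉rest : y₁ ∉ l ++ q ∷ β
        y₁∉rest = nodup-head (nodup-⊆ ρ (v2 ⊕ v4 ⊕ v1 ⊕ v5) all nd)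
        y₁≢y₃ : y₁ ≢ y₃
        y₁≢y₃ eq = y₁∉rest (subst (_∈ l ++ q ∷ β) (≡-sym eq) (hd∈ l))

        -- Since the walk avoids `p` and `y₂`, the ear from `y₁` returns to the cycle in `l`, at `q`
        -- or in `β`. The last contradicts `sep`; the others cut off an arc starting with `y₂`,
        -- shorter than `α` because `y₁` is lost.
        bad₁ : ∀ {k} → Walk y₁ k y₃ → p ∉ k → y₂ ∉ k → ⊥
        bad₁ w₁ p∉ y₂∉ with findEar {_≡ y₁} {_∈ l ++ q ∷ β} (_≟ y₁) (_∈? (l ++ q ∷ β)) w₁ refl (hd∈ l)
        ... | ear {s′ = s′} {k} refl s′∈ wk nk ∉y₁ ∉Q k⊆l _ = go
          where
          disjoint : ∀ {x} → x ∈ (p ∷ y₂ ∷ y₁ ∷ l ++ q ∷ β) → x ∉ k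
          disjoint (here refl) x∈k = p∉ (k⊆l x∈k)
          disjoint (there (here refl)) x∈k = y₂∉ (k⊆l x∈k)
          disjoint (there (there (here refl))) x∈k = ∉y₁ x∈k refl
          disjoint (there (there (there x∈))) x∈k = ∉Q x∈k x∈
          n′ : Nodup ((p ∷ y₂ ∷ y₁ ∷ l ++ q ∷ β) ++ k)
          n′ = nodup-++ {p ∷ y₂ ∷ y₁ ∷ l ++ q ∷ β} (nodup-⊆ ρ (v0 ⊕ v3 ⊕ v2 ⊕ v4 ⊕ v1 ⊕ v5) all nd) nk disjoint
          go : ⊥
          go with ∈-++⁻ l s′∈
          ... | inj₂ (here refl) = fromEar (descend n) len (s≤s z≤n) (step e₂ w) (walk-++ wβ (edge e₁)) wk
                (nodup-⊆ ([ p ] ∷ [ q ] ∷ [ y₁ ] ∷ [ y₂ ] ∷ l ∷ β ∷ k ∷ [])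
                  (v2 ⊕ v1 ⊕ (v3 ⊕ v4) ⊕ (v5 ⊕ v0) ⊕ v6) ((v0 ⊕ v3 ⊕ v2 ⊕ v4 ⊕ v1 ⊕ v5) ⊕ v6) n′)
                λ { (here eq) → av (there (there (here eq))) ; (there (here eq)) → av (there (here eq))
                  ; (there (there x∈)) → av (there (there (there x∈))) }
          ... | inj₂ (there s′∈β) = sep (here refl) s′∈β wk (λ x∈ → p∉ (k⊆l x∈)) (λ x∈ → ∉Q x∈ (∈-++⁺ʳ l (here refl)))
          ... | inj₁ s′∈l with ∈-∃++ s′∈l
          ...   | l₁ , l₂ , refl =
                fromEar (descend n) {α = y₂ ∷ l₁} {β = l₂ ++ q ∷ β ++ p ∷ []} (≤-trans (s≤s shorter) len)
                  (s≤s z≤n) (step e₂ (proj₁ ws)) (walk-++ (proj₂ ws) (walk-++ wβ (edge e₁))) wk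
                  (nodup-⊆ ([ p ] ∷ [ q ] ∷ [ y₁ ] ∷ [ y₂ ] ∷ l₁ ∷ [ s′ ] ∷ l₂ ∷ β ∷ k ∷ [])
                    (v2 ⊕ v5 ⊕ (v3 ⊕ v4) ⊕ (v6 ⊕ v1 ⊕ v7 ⊕ v0) ⊕ v8)
                    ((v0 ⊕ v3 ⊕ v2 ⊕ (v4 ⊕ v5 ⊕ v6) ⊕ v1 ⊕ v7) ⊕ v8) n′)
                  λ { (here eq) → av (there (there (here eq)))
                    ; (there (here refl)) → av (there (there (there (there (∈-++⁺ʳ l₁ (here refl))))))
                    ; (there (there (here eq))) → av (there (there (there (here eq))))
                    ; (there (there (there x∈))) → av (there (there (there (there (∈-++⁺ˡ x∈))))) }
            where
            ws = walk-split l₁ w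
            shorter : length l₁ ≤ length (l₁ ++ s′ ∷ l₂)
            shorter rewrite length-++ l₁ {s′ ∷ l₂} = m≤m+n _ _

        -- The walk is read backwards from `y₂`, with `p` among the targets. A foot in `β`
        -- contradicts `sep`, the foot `p` closes a same-side theta, and any other foot cuts off a
        -- nonempty part of `l`.
        bad₂ : ∀ {k} → Walk p k y₂ → y₁ ∉ k → y₃ ∉ k → ⊥
        bad₂ {k₀} w₁ y₁∉ y₃∉ with findEar {_≡ y₂} {_∈ l ++ q ∷ β ++ [ p ]} (_≟ y₂) (_∈? (l ++ q ∷ β ++ [ p ]))
                                 (walk-reverse w₁) refl (∈-++⁺ʳ l (there (∈-++⁺ʳ β (here refl))))
        ... | ear {s′ = s′} {k} refl s′∈ wk nk ∉y₂ ∉Q k⊆l s′∈k₀ = go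
          where
          disjoint : ∀ {x} → x ∈ (y₁ ∷ y₂ ∷ l ++ q ∷ β ++ [ p ]) → x ∉ k
          disjoint (here refl) x∈k = y₁∉ (reverse⁻ (k⊆l x∈k))
          disjoint (there (here refl)) x∈k = ∉y₂ x∈k refl
          disjoint (there (there x∈)) x∈k = ∉Q x∈k x∈
          n′ : Nodup ((y₁ ∷ y₂ ∷ l ++ q ∷ β ++ [ p ]) ++ k)
          n′ = nodup-++ {y₁ ∷ y₂ ∷ l ++ q ∷ β ++ [ p ]} (nodup-⊆ ρ (v2 ⊕ v3 ⊕ v4 ⊕ v1 ⊕ v5 ⊕ v0) all nd) nk disjoint
          -- The foot `y₃` would leave an empty arc between `y₂` and the foot, to which `fromEar`
          -- does not apply.
          s′≢y₃ : s′ ≢ y₃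
          s′≢y₃ eq = [ (λ s′≡p → p≢y₃ (trans (≡-sym s′≡p) eq))
                     , (λ s′∈ → y₃∉ (subst (_∈ k₀) eq (reverse⁻ s′∈))) ]′ s′∈k₀
            where
            p≢y₃ : p ≢ y₃
            p≢y₃ eq = nodup-disjoint (l ++ [ q ]) (nodup-⊆ ρ ((v4 ⊕ v1) ⊕ v0) all nd) (hd∈ l) (here (≡-sym eq))
          nonempty : ∀ l′ → s′ ≢ hd l′ s′ → 1 ≤ length l′
          nonempty []      ne = ⊥-elim (ne refl)
          nonempty (_ ∷ _) _  = s≤s z≤n
          -- The vertices `p` and `y₂` are two steps apart, hence on the same side. They are joined
          -- through `y₁`, by the ear, and through `l`, `q` and `β`.
          p-case : s′ ≡ p → ⊥
          p-case refl = noTheta (≡-sym (two-steps e₁ e₂)) (step (E-sym e₂) (edge (E-sym e₁))) wk (walk-++ w wβ)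
            (nodup-⊆ ([ p ] ∷ [ q ] ∷ [ y₁ ] ∷ [ y₂ ] ∷ l ∷ β ∷ k ∷ [])
              (v3 ⊕ v0 ⊕ v2 ⊕ v6 ⊕ (v4 ⊕ v1 ⊕ v5)) ((v2 ⊕ v3 ⊕ v4 ⊕ v1 ⊕ v5 ⊕ v0) ⊕ v6) n′)
          cyc : Walk q (β ++ p ∷ y₁ ∷ []) y₂
          cyc = walk-++ wβ (step e₁ (edge e₂))
          go : ⊥
          go with ∈-++⁻ l s′∈
          ... | inj₂ (here refl) = fromEar (descend n) (≤-trans (n≤1+n _) len) (nonempty l s′≢y₃) w cyc wk
                (nodup-⊆ ([ p ] ∷ [ q ] ∷ [ y₁ ] ∷ [ y₂ ] ∷ l ∷ β ∷ k ∷ [])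
                  (v3 ⊕ v1 ⊕ v4 ⊕ (v5 ⊕ v0 ⊕ v2) ⊕ v6) ((v2 ⊕ v3 ⊕ v4 ⊕ v1 ⊕ v5 ⊕ v0) ⊕ v6) n′)
                λ { (here eq) → av (there (there (there (here eq)))) ; (there (here eq)) → av (there (here eq))
                  ; (there (there x∈)) → av (there (there (there (there x∈)))) }
          ... | inj₂ (there s′∈βp) with ∈-++⁻ β s′∈βp
          ...   | inj₂ (here eq) = p-case eq
          ...   | inj₁ s′∈β = sep (there (here refl)) s′∈β wk
                    (λ x∈ → ∉Q x∈ (∈-++⁺ʳ l (there (∈-++⁺ʳ β (here refl))))) (λ x∈ → ∉Q x∈ (∈-++⁺ʳ l (here refl)))
          go | inj₁ s′∈l with ∈-∃++ s′∈l
          ...   | l₁ , l₂ , refl =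
                fromEar (descend n) {α = l₁} {β = l₂ ++ q ∷ β ++ p ∷ y₁ ∷ []}
                  (≤-trans shorter (≤-trans (n≤1+n _) len))
                  (nonempty l₁ (λ eq → s′≢y₃ (trans eq (hd-++ l₁)))) (proj₁ ws) (walk-++ (proj₂ ws) cyc) wk
                  (nodup-⊆ ([ p ] ∷ [ q ] ∷ [ y₁ ] ∷ [ y₂ ] ∷ l₁ ∷ [ s′ ] ∷ l₂ ∷ β ∷ k ∷ [])
                    (v3 ⊕ v5 ⊕ v4 ⊕ (v6 ⊕ v1 ⊕ v7 ⊕ v0 ⊕ v2) ⊕ v8)
                    ((v2 ⊕ v3 ⊕ (v4 ⊕ v5 ⊕ v6) ⊕ v1 ⊕ v7 ⊕ v0) ⊕ v8) n′)
                  λ { (here eq) → av (there (there (there (here eq))))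
                    ; (there (here refl)) → av (there (there (there (there (∈-++⁺ʳ l₁ (here refl))))))
                    ; (there (there x∈)) → av (there (there (there (there (∈-++⁺ˡ x∈))))) }
            where
            ws = walk-split l₁ w
            hd-++ : ∀ l₁ → hd l₁ s′ ≡ hd (l₁ ++ s′ ∷ l₂) q
            hd-++ []      = refl
            hd-++ (_ ∷ _) = refl
            shorter : length l₁ ≤ length (l₁ ++ s′ ∷ l₂)
            shorter rewrite length-++ l₁ {s′ ∷ l₂} = m≤m+n _ _

      -- The first edge of the cycle serves as `β`: it has no interior vertices, so the separation
      -- is vacuous. Triangles are excluded by parity.
      avCycle : ∀ {c α} → Walk c α c → Nodup (c ∷ α) → 2 ≤ length α → (∀ {x} → x ∈ c ∷ α → Av x) → ⊥
      avCycle (step e (edge f)) _ (s≤s ()) _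
      avCycle (step e (step f (edge g))) _ _ _ = opposite g (≡-sym (two-steps e f))
      avCycle {c} {p ∷ α@(_ ∷ _ ∷ _)} (step e w) n _ av =
        descend (length α) ≤-refl (s≤s (s≤s z≤n)) w (edge e)
          (nodup-⊆ ([ c ] ∷ [ p ] ∷ α ∷ [] ∷ []) (v1 ⊕ v0 ⊕ v2 ⊕ v3) (v0 ⊕ v1 ⊕ v2 ⊕ v3)
            (subst Nodup (≡-sym (cong (λ l → c ∷ p ∷ l) (++-identityʳ α))) n))
          (λ { (here eq) → av (there (here eq)) ; (there (here eq)) → av (here eq)
             ; (there (there x∈)) → av (there (there x∈)) })
          (λ _ ())

      -- Forests: even pairs from a path between two disjoint edges.

      Acyclic : Set
      Acyclic = ∀ {c α} → Walk c α c → Nodup (c ∷ α) → 2 ≤ length α → ⊥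

      -- A second walk from v to y closes a cycle through the edge xy.
      closeUp : Acyclic → ∀ {v β x y k} → E x y → Walk v β x → Nodup (v ∷ y ∷ x ∷ β) → Walk v k y → x ∉ k → ⊥
      closeUp acyclic {v} {β} {x} {y} {k₀} e wβ n w x∉
        with findEar {_∈ v ∷ β} {_≡ y} (_∈? (v ∷ β)) (_≟ y) w (here refl) refl
      ... | ear {s} {k = k} s∈ refl wk nk ∉vβ ∉y k⊆l _ = close s∈
        where
        disjoint : ∀ {z} → z ∈ v ∷ y ∷ x ∷ β → z ∉ k
        disjoint (here refl) z∈k = ∉vβ z∈k (here refl)
        disjoint (there (here refl)) z∈k = ∉y z∈k refl
        disjoint (there (there (here refl))) z∈k = x∉ (k⊆l z∈k)
        disjoint (there (there (there z∈β))) z∈k = ∉vβ z∈k (there z∈β)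
        n′ : Nodup ((v ∷ y ∷ x ∷ β) ++ k)
        n′ = nodup-++ {v ∷ y ∷ x ∷ β} n nk disjoint
        long : ∀ xs (ys : List W) {z t} → 2 ≤ length (xs ++ z ∷ ys ++ [ t ])
        long []       []       = s≤s (s≤s z≤n)
        long []       (_ ∷ _)  = s≤s (s≤s z≤n)
        long (_ ∷ xs) ys       = ≤-trans (long xs ys) (n≤1+n _)
        close : s ∈ v ∷ β → ⊥
        close (here refl) = acyclic (walk-++ (walk-reverse wβ) (walk-++ wk (edge (E-sym e))))
          (nodup-⊆ ([ v ] ∷ [ y ] ∷ [ x ] ∷ β ∷ k ∷ []) (v2 ⊕ rev v3 ⊕ v0 ⊕ v4 ⊕ v1) ((v0 ⊕ v1 ⊕ v2 ⊕ v3) ⊕ v4) n′)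
          (long (reverse β) k)
        close (there s∈β) with ∈-∃++ s∈β
        ... | β₁ , β₂ , refl =
          acyclic (walk-++ (walk-reverse (proj₂ (walk-split β₁ wβ))) (walk-++ wk (edge (E-sym e))))
            (nodup-⊆ ([ v ] ∷ [ y ] ∷ [ x ] ∷ β₁ ∷ [ s ] ∷ β₂ ∷ k ∷ [])
              (v2 ⊕ rev v5 ⊕ v4 ⊕ v6 ⊕ v1) ((v0 ⊕ v1 ⊕ v2 ⊕ (v3 ⊕ v4 ⊕ v5)) ⊕ v6) n′)
            (long (reverse β₂) k)

      module _ (acyclic : Acyclic) (Av? : ∀ x → Dec (Av x)) where

        private
          -- In a forest the path `u`, `v`, `κ`, `n`, `y` is the only one between its ends. A walk
          -- from `v` to `y` that misses `n`, or from `u` to `n` that misses `v`, would close a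
          -- cycle.
          odd-path : ∀ {u v n y κ} → E u v → E n y → Walk v κ n → side v ≡ side y →
                     Nodup (u ∷ v ∷ y ∷ n ∷ κ) → Av u → Av v → Av n → Av y → ⊥
          odd-path {u} {v} {n} {y} {κ} e f w eq nd au av an ay =
            noGood e f (across (E-sym e) (E-sym f) eq) u≢n v≢y au av an ay
              (λ w′ u∉ n∉ → closeUp acyclic f w (nodup-⊆ ρ (v1 ⊕ v2 ⊕ v3 ⊕ v4) all nd) w′ n∉)
              (λ w′ v∉ y∉ → closeUp acyclic (E-sym e) (walk-reverse w) (nodup-⊆ ρ (v3 ⊕ v0 ⊕ v1 ⊕ rev v4) all nd)
                              (walk-reverse w′) (λ v∈ → v∉ (reverse⁻ v∈)))
            where
            ρ = [ u ] ∷ [ v ] ∷ [ y ] ∷ [ n ] ∷ κ ∷ []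
            all : Expr 5
            all = v0 ⊕ v1 ⊕ v2 ⊕ v3 ⊕ v4
            u≢n : u ≢ n
            u≢n eq = nodup-head (nodup-⊆ ρ (v0 ⊕ v3) all nd) (here eq)
            v≢y : v ≢ y
            v≢y eq = nodup-head (nodup-⊆ ρ (v1 ⊕ v2) all nd) (here eq)

          -- The path from `v` to `y` has an even number of edges, so without its last or its first
          -- edge it is odd. This gives the pair of `uv` with the last edge `n₂y`, or of `xy` with
          -- the first edge `vn₁`; by the final hypothesis `n₁` and `n₂` do not both violate `Av`.
          even-path : ∀ {u v x y k} → E u v → E x y → side v ≡ side y → Walk v k y → u ≢ x → v ≢ y →
                      Av u → Av v → Av x → Av y → u ∉ k → x ∉ k →
                      (∀ {n₁ n₂} → E v n₁ → E y n₂ → side n₁ ≡ side n₂ → ¬ Av n₁ → ¬ Av n₂ → ⊥) → ⊥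
          even-path {u} {v} {x} {y} e f eq w₀ u≢x v≢y au av ax ay u∉ x∉ unav with findPath w₀ v≢y
          ... | k , w , nk , k⊆ = go (initLast k) w nk (λ u∈ → u∉ (k⊆ u∈)) (λ x∈ → x∉ (k⊆ x∈))
            where
            u≢v : u ≢ v
            u≢v refl = opposite e refl
            x≢y : x ≢ y
            x≢y refl = opposite f refl
            u≢y : u ≢ y
            u≢y refl = opposite e (≡-sym eq)
            x≢v : x ≢ v
            x≢v refl = opposite f eq
            cons : ∀ {z k} → z ≢ v → z ≢ y → z ∉ k → Nodup (v ∷ y ∷ k) → Nodup (z ∷ v ∷ y ∷ k)
            cons z≢v z≢y z∉k = nodup-∷ λ { (here eq) → z≢v eq ; (there (here eq)) → z≢y eq ; (there (there z∈)) → z∉k z∈ }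
            go : ∀ {k} → InitLast k → Walk v k y → Nodup (v ∷ y ∷ k) → u ∉ k → x ∉ k → ⊥
            go [] (edge g) _ _ _ = opposite g eq
            go (k′ ∷ʳ′ n₂) w nk u∉ x∉ with walk-split k′ w
            ... | w′ , edge g with Av? n₂
            ...   | yes an₂ = odd-path e g w′ eq
                      (nodup-⊆ ([ u ] ∷ [ v ] ∷ [ y ] ∷ [ n₂ ] ∷ k′ ∷ []) (v0 ⊕ v1 ⊕ v2 ⊕ v3 ⊕ v4) (v0 ⊕ v1 ⊕ v2 ⊕ v4 ⊕ v3)
                        (cons u≢v u≢y u∉ nk)) au av an₂ ay
            ...   | no ¬an₂ with k′ ++ n₂ ∷ [] | w
            ...     | [] | edge h = opposite h eq
            ...     | n₁ ∷ k₁ | step h w″ with Av? n₁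
            ...       | no ¬an₁ = unav h (E-sym g) (across h (E-sym g) eq) ¬an₁ ¬an₂
            ...       | yes an₁ = odd-path f (E-sym h) (walk-reverse w″) (≡-sym eq)
                          (nodup-⊆ ([ x ] ∷ [ v ] ∷ [ y ] ∷ [ n₁ ] ∷ k₁ ∷ []) (v0 ⊕ v2 ⊕ v1 ⊕ v3 ⊕ rev v4) (v0 ⊕ v1 ⊕ v2 ⊕ v3 ⊕ v4)
                            (cons x≢v x≢y x∉ nk)) ax ay an₁ av

        -- If `uv` and `xy` fail to be a good pair, the walk responsible for the failure supplies
        -- the path for `even-path`, at one pair of ends or at the other.
        acyclic-good : ∀ {u v x y} → E u v → E x y → side u ≡ side x → u ≢ x → v ≢ y → Av u → Av v → Av x → Av y →
          (∀ {n₁ n₂} → E v n₁ → E y n₂ → side n₁ ≡ side n₂ → ¬ Av n₁ → ¬ Av n₂ → ⊥) →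
          (∀ {n₁ n₂} → E u n₁ → E x n₂ → side n₁ ≡ side n₂ → ¬ Av n₁ → ¬ Av n₂ → ⊥) → ⊥
        acyclic-good e f eq u≢x v≢y au av ax ay unav₁ unav₂ =
          noGood e f eq u≢x v≢y au av ax ay
            (λ w u∉ x∉ → even-path e f (across e f eq) w u≢x v≢y au av ax ay u∉ x∉ unav₁)
            (λ w v∉ y∉ → even-path (E-sym e) (E-sym f) eq w v≢y u≢x av au ay ax v∉ y∉ unav₂)

      -- One degree-two vertex to avoid: the small component.

      module DegreeTwoVertex {w p q : W} (wp : E w p) (wq : E w q) (p≢q : p ≢ q)
        (neighbours : ∀ {n} → E w n → n ≡ p ⊎ n ≡ q)
        (≢w⇒Av : ∀ {z} → z ≢ w → Av z) (Av⇒≢w : ∀ {z} → Av z → z ≢ w) where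

        private
          p~q : side p ≡ side q
          p~q = two-steps (E-sym wp) wq

          -- The complementary arc is `w` alone. As `w` has no neighbours besides `p` and `q`,
          -- `barrier` supplies the separation that the descent requires.
          notLong : ∀ {α} → Walk p α q → Nodup (w ∷ p ∷ q ∷ α) → 2 ≤ length α → ⊥
          notLong {α} wα n len = descend (length α) ≤-refl len wα (step (E-sym wq) (edge wp))
            (nodup-⊆ ([ w ] ∷ [ p ] ∷ [ q ] ∷ α ∷ []) (v1 ⊕ v2 ⊕ v3 ⊕ v0) (v0 ⊕ v1 ⊕ v2 ⊕ v3) n)
            (λ x∈ → ≢w⇒Av λ { refl → nodup-head n x∈ })
            (λ { {s} s∈ (here refl) w′ p∉ q∉ → barrier {_≡ w} (_≟ w) (λ { refl Ewx → inj₂ (neighbours Ewx) }) w′ refl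
                    (λ { refl → nodup-head n (there (there s∈)) })
                    (λ { refl → nodup-head (nodup-⊆ ρ (v1 ⊕ v3) all n) s∈ })
                    (λ { refl → nodup-head (nodup-⊆ ρ (v2 ⊕ v3) all n) s∈ }) p∉ q∉ })
            where
            ρ = [ w ] ∷ [ p ] ∷ [ q ] ∷ α ∷ []
            all : Expr 4
            all = v0 ⊕ v1 ⊕ v2 ⊕ v3

          Square : ∀ α → Set
          Square α = Σ W λ r → E p r × E q r × r ≢ w × (∀ {x} → x ∈ w ∷ α → x ∈ w ∷ p ∷ q ∷ r ∷ [])

          short : ∀ {α β} → Walk p β q → Nodup (w ∷ p ∷ q ∷ β) → (∀ {x} → x ∈ α → x ∈ p ∷ q ∷ β) → Square α
          short (edge e) _ _ = ⊥-elim (opposite e p~q)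
          short {α} (step {c = r} e (edge f)) n α⊆ = r , e , E-sym f
            , (λ { refl → nodup-head n (there (there (here refl))) })
            , λ { (here eq) → here eq ; (there x∈) → there (α⊆ x∈) }
          short wβ@(step _ (step _ _)) n _ = ⊥-elim (notLong wβ n (s≤s (s≤s z≤n)))

          through : ∀ {α} → Walk w α w → Nodup (w ∷ α) → 2 ≤ length α → Square α
          through {n₁ ∷ α} (step e wα) n len with initLast α
          ... | [] with () ← (s≤s⁻¹ len)
          ... | β ∷ʳ′ n₂ with walk-split β wα
          ...   | wβ , edge f = ends (neighbours e) (neighbours (E-sym f))
            where
            ρ = [ w ] ∷ [ n₁ ] ∷ β ∷ [ n₂ ] ∷ []
            all : Expr 4
            all = v0 ⊕ v1 ⊕ v2 ⊕ v3
            n₁≢n₂ : n₁ ≢ n₂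
            n₁≢n₂ eq = nodup-head (nodup-⊆ ρ (v1 ⊕ v3) all n) (here eq)
            ends : n₁ ≡ p ⊎ n₁ ≡ q → n₂ ≡ p ⊎ n₂ ≡ q → Square (n₁ ∷ β ++ [ n₂ ])
            ends (inj₁ refl) (inj₁ refl) = ⊥-elim (n₁≢n₂ refl)
            ends (inj₂ refl) (inj₂ refl) = ⊥-elim (n₁≢n₂ refl)
            ends (inj₁ refl) (inj₂ refl) = short wβ (nodup-⊆ ρ (v0 ⊕ v1 ⊕ v3 ⊕ v2) all n)
              λ { (here eq) → here eq ; (there x∈) → [ (λ x∈ → there (there x∈)) , (λ { (here eq) → there (here eq) }) ]′ (∈-++⁻ β x∈) }
            ends (inj₂ refl) (inj₁ refl) = short (walk-reverse wβ) (nodup-⊆ ρ (v0 ⊕ v3 ⊕ v1 ⊕ rev v2) all n)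
              λ { (here eq) → there (here eq) ; (there x∈) → [ (λ x∈ → there (there (reverse⁺ x∈))) , (λ { (here eq) → here eq }) ]′ (∈-++⁻ β x∈) }

          -- A cycle that misses `w` falls to `avCycle`. One through `w` passes through `p` and `q`,
          -- and by `notLong` and parity its other arc between them has a single interior vertex
          -- `r`.
          cycle-square : ∀ {c α} → Walk c α c → Nodup (c ∷ α) → 2 ≤ length α →
            Σ W λ r → E p r × E q r × r ≢ w × (∀ {x} → x ∈ c ∷ α → x ∈ w ∷ p ∷ q ∷ r ∷ [])
          cycle-square {c} {α} wα n len with w ∈? (c ∷ α)
          ... | no w∉ = ⊥-elim (avCycle wα n len (λ x∈ → ≢w⇒Av λ { refl → w∉ x∈ }))
          ... | yes w∈ with rotate wα n len w∈
          ...   | α′ , w′ , n′ , len′ , sub with through w′ n′ len′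
          ...     | r , pr , qr , r≢w , sub′ = r , pr , qr , r≢w , λ x∈ → sub′ (sub x∈)

        module _ {u v x y : W} (e : E u v) (f : E x y) (eq : side u ≡ side x) (u≢x : u ≢ x) (v≢y : v ≢ y)
          (u≢w : u ≢ w) (v≢w : v ≢ w) (x≢w : x ≢ w) (y≢w : y ≢ w)
          (u≢p : u ≢ p) (v≢p : v ≢ p) (x≢p : x ≢ p) (y≢p : y ≢ p) where

          private
            module WithSquare {r : W} (pr : E p r) (qr : E q r) (r≢w : r ≢ w) where

              C : W → Set
              C z = z ∈ w ∷ p ∷ q ∷ r ∷ []

              p≢w : p ≢ w
              p≢w refl = opposite wp refl
              q≢w : q ≢ w
              q≢w refl = opposite wq refl

              -- Every cycle lies on a square through `w`, and the square is unique: a second common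
              -- neighbour `r′` would give the cycle `r`, `p`, `r′`, `q`, which misses `w`.
              cycle-C : ∀ {c α} → Walk c α c → Nodup (c ∷ α) → 2 ≤ length α → ∀ {z} → z ∈ c ∷ α → C z
              cycle-C wα n len z∈ with cycle-square wα n len
              ... | r′ , pr′ , qr′ , r′≢w , sub with r′ ≟ r | sub z∈
              ... | yes refl | z∈C = z∈C
              ... | no r′≢r | _ = ⊥-elim (avCycle
                      (step (E-sym pr) (step pr′ (step (E-sym qr′) (edge qr))))
                      nd (s≤s (s≤s z≤n))
                      λ { (here refl) → ≢w⇒Av r≢w ; (there (here refl)) → ≢w⇒Av p≢w
                        ; (there (there (here refl))) → ≢w⇒Av r′≢w ; (there (there (there (here refl)))) → ≢w⇒Av q≢w })
                where
                r≢p : r ≢ p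
                r≢p refl = opposite pr refl
                r≢q : r ≢ q
                r≢q refl = opposite qr refl
                r′≢p : r′ ≢ p
                r′≢p refl = opposite pr′ refl
                r′≢q : r′ ≢ q
                r′≢q refl = opposite qr′ refl
                nd : Nodup (r ∷ p ∷ r′ ∷ q ∷ [])
                nd = nodup-∷ (λ { (here a) → r≢p a ; (there (here a)) → r′≢r (≡-sym a) ; (there (there (here a))) → r≢q a })
                  (nodup-∷ (λ { (here a) → r′≢p (≡-sym a) ; (there (here a)) → p≢q a })
                    (nodup-∷ (λ { (here a) → r′≢q a }) (nodup-∷ (λ ()) (nodup (λ _ → z≤n)))))

              closeEdge : ∀ {v v′ z k} → E v v′ → E v′ z → v ≢ z → Walk v k z → v′ ∉ k → C v × C v′
              closeEdge {v} {v′} {z} g h v≢z w₀ v′∉ with findPath w₀ v≢z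
              ... | k , wk , nk , k⊆ = on (there (here refl)) , on (here refl)
                where
                cyc : Walk v′ (v ∷ k ++ [ z ]) v′
                cyc = step (E-sym g) (walk-++ wk (edge (E-sym h)))
                v′∉vzk : v′ ∉ v ∷ z ∷ k
                v′∉vzk (here refl)         = opposite g refl
                v′∉vzk (there (here refl)) = opposite h refl
                v′∉vzk (there (there v′∈)) = v′∉ (k⊆ v′∈)
                two : ∀ (l : List W) → 2 ≤ length (v ∷ l ++ [ z ])
                two []      = s≤s (s≤s z≤n)
                two (_ ∷ _) = s≤s (s≤s z≤n)
                on : ∀ {t} → t ∈ v′ ∷ v ∷ k ++ [ z ] → C t
                on = cycle-C cyc (nodup-⊆ ([ v′ ] ∷ [ v ] ∷ [ z ] ∷ k ∷ []) (v0 ⊕ v1 ⊕ v3 ⊕ v2) (v0 ⊕ v1 ⊕ v2 ⊕ v3)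
                       (nodup-∷ v′∉vzk nk)) (two k)

              -- If the middle edge `vv′` is off the square, it lies on no cycle by `closeEdge`. No
              -- walk then bypasses `v′` or `v`, and the outer edges form a good pair.
              in-C : ∀ {u v v′ z} → E u v → E v v′ → E v′ z → u ≢ v′ → v ≢ z → ¬ (C v × C v′) → u ≢ w → z ≢ w → ⊥
              in-C {u} {v} {v′} {z} e g h u≢v′ v≢z ¬C u≢w z≢w =
                noGood e h (two-steps e g) u≢v′ v≢z (≢w⇒Av u≢w) (≢w⇒Av v≢w′) (≢w⇒Av v′≢w) (≢w⇒Av z≢w)
                  (λ w _ v′∉ → ¬C (closeEdge g h v≢z w v′∉))
                  (λ w v∉ _ → ¬C (swap (closeEdge (E-sym g) (E-sym e) (λ a → u≢v′ (≡-sym a)) (walk-reverse w)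
                                 (λ v∈ → v∉ (reverse⁻ v∈)))))
                where
                nbr-C : ∀ {t} → E w t → C t
                nbr-C Ewt with neighbours Ewt
                ... | inj₁ refl = there (here refl)
                ... | inj₂ refl = there (there (here refl))
                v≢w′ : v ≢ w
                v≢w′ refl = ¬C (here refl , nbr-C g)
                v′≢w : v′ ≢ w
                v′≢w refl = ¬C (nbr-C (E-sym g) , here refl)

              -- An end at w is replaced by r: both are common neighbours of p and q.
              swap-end : ∀ {v v′ z} → E v v′ → E v′ z → v ≢ z → ¬ (C v × C v′) →
                         Σ W λ z′ → E v′ z′ × v ≢ z′ × z′ ≢ w
              swap-end {v} {v′} {z} g h v≢z ¬C with z ≟ w
              ... | no z≢w = z , h , v≢z , z≢w
              ... | yes refl with neighbours (E-sym h)
              ...   | inj₁ refl = r , pr , (λ { refl → ¬C (there (there (there (here refl))) , there (here refl)) }) , r≢w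
              ...   | inj₂ refl = r , qr , (λ { refl → ¬C (there (there (there (here refl))) , there (there (here refl))) }) , r≢w

              -- An outer end at `w` would violate `Av`, so both outer ends are moved off `w` before
              -- `in-C` is applied.
              middle-in-C : ∀ {u v v′ z} → E u v → E v v′ → E v′ z → u ≢ v′ → v ≢ z → ¬ (C v × C v′) → ⊥
              middle-in-C e g h u≢v′ v≢z ¬C with swap-end g h v≢z ¬C
                | swap-end (E-sym g) (E-sym e) (λ a → u≢v′ (≡-sym a)) (λ c → ¬C (swap c))
              ... | z′ , h′ , v≢z′ , z′≢w | u′ , e′ , v′≢u′ , u′≢w =
                in-C (E-sym e′) g h′ (λ a → v′≢u′ (≡-sym a)) v≢z′ ¬C u′≢w z′≢w

              q-or-r : ∀ {z} → C z → z ≢ w → z ≢ p → z ≡ q ⊎ z ≡ r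
              q-or-r (here a)                         z≢w _   = ⊥-elim (z≢w a)
              q-or-r (there (here a))                 _   z≢p = ⊥-elim (z≢p a)
              q-or-r (there (there (here a)))         _   _   = inj₁ a
              q-or-r (there (there (there (here a)))) _   _   = inj₂ a

              unique : ∀ {v y} → v ≡ q ⊎ v ≡ r → y ≡ q ⊎ y ≡ r → side v ≡ side y → v ≡ y
              unique (inj₁ refl) (inj₁ refl) _ = refl
              unique (inj₂ refl) (inj₂ refl) _ = refl
              unique (inj₁ refl) (inj₂ refl) a = ⊥-elim (opposite qr a)
              unique (inj₂ refl) (inj₁ refl) a = ⊥-elim (opposite qr (≡-sym a))

              -- The edge `uv` followed by the first two edges of the path forces `v` onto the
              -- square; symmetrically for `y`. Being neither `w` nor `p`, both lie among the
              -- adjacent vertices `q` and `r`, and being on the same side they coincide.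
              bad : ∀ {u v x y k} → E u v → E x y → side u ≡ side x → v ≢ y → v ≢ w → y ≢ w → v ≢ p → y ≢ p →
                    Walk v k y → u ∉ k → x ∉ k → ⊥
              bad {u} {v} {x} {y} e f eq v≢y v≢w y≢w v≢p y≢p w₀ u∉ x∉ with findPath w₀ v≢y
              ... | k , wk , nk , k⊆ = v≢y (unique (q-or-r Cv v≢w v≢p) (q-or-r Cy y≢w y≢p) (across e f eq))
                where
                onSquare : ∀ {u v y k} → E u v → Walk v k y → Nodup (v ∷ y ∷ k) → u ∉ k → side v ≡ side y → C v
                onSquare e (edge g) _ _ s = ⊥-elim (opposite g s)
                onSquare {u} {v} {y} {n ∷ k} e (step g w′) nk u∉ s with v ∈? (w ∷ p ∷ q ∷ r ∷ [])
                ... | yes Cv = Cv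
                ... | no ¬Cv = ⊥-elim (middle-in-C e g (walk-hd w′) (λ { refl → u∉ (here refl) }) (v≢hd k nk)
                                 (λ c → ¬Cv (proj₁ c)))
                  where
                  v≢hd : ∀ k → Nodup (v ∷ y ∷ n ∷ k) → v ≢ hd k y
                  v≢hd []      nk a = nodup-head nk (here a)
                  v≢hd (_ ∷ _) nk a = nodup-head nk (there (there (here a)))
                Cv = onSquare e wk nk (λ u∈ → u∉ (k⊆ u∈)) (across e f eq)
                Cy = onSquare f (walk-reverse wk)
                       (nodup-⊆ ([ v ] ∷ [ y ] ∷ k ∷ []) (v1 ⊕ v0 ⊕ rev v2) (v0 ⊕ v1 ⊕ v2) nk)
                       (λ x∈ → x∉ (k⊆ (reverse⁻ x∈))) (≡-sym (across e f eq))

            noSquare : ∀ {r} → E p r → E q r → r ≢ w → ⊥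
            noSquare pr qr r≢w = noGood e f eq u≢x v≢y (≢w⇒Av u≢w) (≢w⇒Av v≢w) (≢w⇒Av x≢w) (≢w⇒Av y≢w)
              (bad e f eq v≢y v≢w y≢w v≢p y≢p)
              (bad (E-sym e) (E-sym f) (across e f eq) u≢x u≢w x≢w u≢p x≢p)
              where open WithSquare pr qr r≢w

            is-q : ∀ {v n} → E v n → v ≢ p → ¬ Av n → v ≡ q
            is-q {n = n} g v≢p ¬an with n ≟ w
            ... | no n≢w = ⊥-elim (¬an (≢w⇒Av n≢w))
            ... | yes refl with neighbours (E-sym g)
            ...   | inj₁ v≡p = ⊥-elim (v≢p v≡p)
            ...   | inj₂ v≡q = v≡q

            Av? : ∀ z → Dec (Av z)
            Av? z with z ≟ w
            ... | yes z≡w = no (λ az → Av⇒≢w az z≡w)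
            ... | no z≢w  = yes (≢w⇒Av z≢w)

          -- A cycle produces a square, which `noSquare` refutes, so the graph is a forest. Two
          -- neighbours violating `Av` would both be `w`, and the ends next to them, not being `p`,
          -- would both be `q`.
          degree-two-good : ⊥
          degree-two-good = acyclic-good
            (λ wα n len → let _ , pr , qr , r≢w , _ = cycle-square wα n len in noSquare pr qr r≢w) Av?
            e f eq u≢x v≢y (≢w⇒Av u≢w) (≢w⇒Av v≢w) (≢w⇒Av x≢w) (≢w⇒Av y≢w)
            (λ g h _ a b → v≢y (trans (is-q g v≢p a) (≡-sym (is-q h y≢p b))))
            (λ g h _ a b → u≢x (trans (is-q g u≢p a) (≡-sym (is-q h x≢p b))))

      -- Two adjacent degree-two vertices to avoid: the light component.

      module DegreeTwoEdge {p a b s : W} (ap : E a p) (ab : E a b) (bs : E b s)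
        (neighbours-a : ∀ {n} → E a n → n ≡ p ⊎ n ≡ b) (neighbours-b : ∀ {n} → E b n → n ≡ a ⊎ n ≡ s)
        (¬ps : ¬ E p s)
        (⇒Av : ∀ {z} → z ≢ a → z ≢ b → Av z) (Av⇒ : ∀ {z} → Av z → z ≢ a × z ≢ b) where

        private
          I : W → Set
          I z = z ≡ a ⊎ z ≡ b

          I? : ∀ z → Dec (I z)
          I? z = (z ≟ a) ⊎-dec (z ≟ b)

          p≁s : side p ≢ side s
          p≁s eq = opposite ab (≡-sym (trans (two-steps (E-sym ab) ap) (trans eq (≡-sym (two-steps ab bs)))))

          -- The complementary arc consists of `a` and `b`, attached to the rest only at `p` and
          -- `s`. The arcs too short for the descent are excluded by `¬ps` and by parity.
          noArc : ∀ {α} → Walk s α p → Nodup (a ∷ b ∷ p ∷ s ∷ α) → ⊥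
          noArc (edge e) _ = ¬ps (E-sym e)
          noArc (step e (edge f)) _ = p≁s (≡-sym (two-steps e f))
          noArc {α} wα@(step _ (step _ _)) n = descend (length α) ≤-refl (s≤s (s≤s z≤n)) wα
            (step (E-sym ap) (step ab (edge bs)))
            (nodup-⊆ ρ (v3 ⊕ v2 ⊕ v4 ⊕ v0 ⊕ v1) all n)
            (λ { (here refl) → ⇒Av (λ { refl → nodup-head n (there (there (here refl))) })
                                   (λ { refl → nodup-head (nodup-⊆ ρ (v1 ⊕ v3) all n) (here refl) })
               ; (there (here refl)) → ⇒Av (λ { refl → nodup-head n (there (here refl)) })
                                   (λ { refl → nodup-head (nodup-⊆ ρ (v1 ⊕ v2) all n) (here refl) })
               ; (there (there x∈)) → ⇒Av (λ { refl → a∉ x∈ }) (λ { refl → b∉ x∈ }) })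
            (λ { s∈ t∈ w s∉ p∉ → barrier {I} I? attach w (I-of t∈)
                    (λ { (inj₁ refl) → a∉ s∈ ; (inj₂ refl) → b∉ s∈ })
                    (λ { refl → nodup-head (nodup-⊆ ρ (v2 ⊕ v4) all n) s∈ })
                    (λ { refl → nodup-head (nodup-⊆ ρ (v3 ⊕ v4) all n) s∈ }) p∉ s∉ })
            where
            ρ = [ a ] ∷ [ b ] ∷ [ p ] ∷ [ s ] ∷ α ∷ []
            all : Expr 5
            all = v0 ⊕ v1 ⊕ v2 ⊕ v3 ⊕ v4
            a∉ : a ∉ α
            a∉ = nodup-head (nodup-⊆ ρ (v0 ⊕ v4) all n)
            b∉ : b ∉ α
            b∉ = nodup-head (nodup-⊆ ρ (v1 ⊕ v4) all n)
            I-of : ∀ {t} → t ∈ a ∷ b ∷ [] → I t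
            I-of (here eq)         = inj₁ eq
            I-of (there (here eq)) = inj₂ eq
            attach : ∀ {x t} → I t → E t x → I x ⊎ x ≡ p ⊎ x ≡ s
            attach (inj₁ refl) e with neighbours-a e
            ... | inj₁ eq = inj₂ (inj₁ eq)
            ... | inj₂ eq = inj₁ (inj₂ eq)
            attach (inj₂ refl) e with neighbours-b e
            ... | inj₁ eq = inj₁ (inj₁ eq)
            ... | inj₂ eq = inj₂ (inj₂ eq)

          noArc′ : ∀ {α} → Walk b α p → Nodup (a ∷ b ∷ p ∷ α) → ⊥
          noArc′ (edge e) _ with neighbours-b e
          ... | inj₁ refl = opposite ap refl
          ... | inj₂ refl = p≁s refl
          noArc′ {c ∷ α} (step e w) n with neighbours-b e
          ... | inj₁ refl = nodup-head n (there (there (here refl)))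
          ... | inj₂ refl = noArc w n

          noneThrough-a : ∀ {α} → Walk a α a → Nodup (a ∷ α) → 2 ≤ length α → ⊥
          noneThrough-a {n₁ ∷ α} (step e wα) n len with initLast α
          ... | [] with () ← (s≤s⁻¹ len)
          ... | β ∷ʳ′ n₂ with walk-split β wα
          ...   | wβ , edge f = ends (neighbours-a e) (neighbours-a (E-sym f))
            where
            ρ = [ a ] ∷ [ n₁ ] ∷ β ∷ [ n₂ ] ∷ []
            all : Expr 4
            all = v0 ⊕ v1 ⊕ v2 ⊕ v3
            n₁≢n₂ : n₁ ≢ n₂
            n₁≢n₂ eq = nodup-head (nodup-⊆ ρ (v1 ⊕ v3) all n) (here eq)
            ends : n₁ ≡ p ⊎ n₁ ≡ b → n₂ ≡ p ⊎ n₂ ≡ b → ⊥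
            ends (inj₁ refl) (inj₁ refl) = n₁≢n₂ refl
            ends (inj₂ refl) (inj₂ refl) = n₁≢n₂ refl
            ends (inj₁ refl) (inj₂ refl) = noArc′ (walk-reverse wβ) (nodup-⊆ ρ (v0 ⊕ v3 ⊕ v1 ⊕ rev v2) all n)
            ends (inj₂ refl) (inj₁ refl) = noArc′ wβ (nodup-⊆ ρ (v0 ⊕ v1 ⊕ v3 ⊕ v2) all n)

          -- A cycle uses two distinct neighbours of `b`, so not only `s`. Cycles through `b`
          -- thereby reduce to cycles through `a`.
          a∈cycle : ∀ {α} → Walk b α b → Nodup (b ∷ α) → 2 ≤ length α → a ∈ α
          a∈cycle {n₁ ∷ α} (step e wα) n len with neighbours-b e
          ... | inj₁ refl = here refl
          ... | inj₂ refl with initLast α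
          ...   | [] with () ← (s≤s⁻¹ len)
          ...   | β ∷ʳ′ n₂ with walk-split β wα
          ...     | wβ , edge f with neighbours-b (E-sym f)
          ...       | inj₁ refl = there (∈-++⁺ʳ β (here refl))
          ...       | inj₂ refl = ⊥-elim (nodup-head (nodup-⊆ ([ b ] ∷ [ s ] ∷ β ∷ []) (v1 ⊕ v1) (v0 ⊕ v1 ⊕ v2 ⊕ v1) n) (here refl))

          acyclic : Acyclic
          acyclic {c} {α} wα n len with a ∈? (c ∷ α) | b ∈? (c ∷ α)
          ... | no a∉ | no b∉ = avCycle wα n len (λ x∈ → ⇒Av (λ { refl → a∉ x∈ }) (λ { refl → b∉ x∈ }))
          ... | yes a∈ | _ = let _ , w , n′ , len′ , _ = rotate wα n len a∈ in noneThrough-a w n′ len′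
          ... | no a∉ | yes b∈ =
            let _ , wb , nb , lenb , _ = rotate wα n len b∈
                _ , w , n′ , len′ , _  = rotate wb nb lenb (there (a∈cycle wb nb lenb))
            in noneThrough-a w n′ len′

          attached : ∀ {v n} → E v n → Av v → ¬ Av n → (n ≡ a × v ≡ p) ⊎ (n ≡ b × v ≡ s)
          attached {v} {n} e av ¬an with I? n
          ... | no ¬I = ⊥-elim (¬an (⇒Av (λ eq → ¬I (inj₁ eq)) (λ eq → ¬I (inj₂ eq))))
          ... | yes (inj₁ refl) with neighbours-a (E-sym e)
          ...   | inj₁ eq = inj₁ (refl , eq)
          ...   | inj₂ eq = ⊥-elim (proj₂ (Av⇒ av) eq)
          attached {v} {n} e av ¬an | yes (inj₂ refl) with neighbours-b (E-sym e)
          ...   | inj₁ eq = ⊥-elim (proj₁ (Av⇒ av) eq)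
          ...   | inj₂ eq = inj₂ (refl , eq)

          -- As `a` and `b` are on opposite sides, `n₁` and `n₂` are the same one of them, and each
          -- has just one neighbour satisfying `Av`.
          same : ∀ {v y n₁ n₂} → Av v → Av y → E v n₁ → E y n₂ → side n₁ ≡ side n₂ → ¬ Av n₁ → ¬ Av n₂ → v ≡ y
          same av ay e f eq a b with attached e av a | attached f ay b
          ... | inj₁ (_ , refl)    | inj₁ (_ , refl)    = refl
          ... | inj₂ (_ , refl)    | inj₂ (_ , refl)    = refl
          ... | inj₁ (refl , refl) | inj₂ (refl , refl) = ⊥-elim (opposite ab eq)
          ... | inj₂ (refl , refl) | inj₁ (refl , refl) = ⊥-elim (opposite ab (≡-sym eq))

          Av? : ∀ z → Dec (Av z)
          Av? z with I? z
          ... | yes (inj₁ eq) = no (λ az → proj₁ (Av⇒ az) eq)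
          ... | yes (inj₂ eq) = no (λ az → proj₂ (Av⇒ az) eq)
          ... | no ¬I         = yes (⇒Av (λ eq → ¬I (inj₁ eq)) (λ eq → ¬I (inj₂ eq)))

        degree-two-edge-good : ∀ {u v x y} → E u v → E x y → side u ≡ side x → u ≢ x → v ≢ y →
                               Av u → Av v → Av x → Av y → ⊥
        degree-two-edge-good e f eq u≢x v≢y au av ax ay = acyclic-good acyclic Av? e f eq u≢x v≢y au av ax ay
          (λ g h sd ¬a ¬b → v≢y (same av ay g h sd ¬a ¬b))
          (λ g h sd ¬a ¬b → u≢x (same au ax g h sd ¬a ¬b))

parity : ∀ n → Even n ⊎ Odd n
parity zero    = inj₁ even-zero
parity (suc n) with parity n
... | inj₁ ev = inj₂ (odd-suc ev)
... | inj₂ od = inj₁ (even-suc od)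

-- The sequence of edges along a walk.

module WalkEdges {W X : Set} (_≟_ : DecidableEquality W) (Joins : X → W → W → Set)
  (joins-sym : ∀ {t u v} → Joins t u v → Joins t v u) where

  open Multiplicity _≟_
  open Walks _≟_ (λ u v → Σ X λ t → Joins t u v) (λ (t , j) → t , joins-sym j)

  edgeAt : ∀ {a l b} → Walk a l b → Fin (suc (length l)) → X
  edgeAt (edge (t , _))   zero    = t
  edgeAt (step (t , _) w) zero    = t
  edgeAt (step _ w)       (suc j) = edgeAt w j

  src tgt : ∀ {a l b} → Walk a l b → Fin (suc (length l)) → W
  src {a} _          zero    = a
  src     (step _ w) (suc j) = src w j
  tgt {b = b} (edge _)       zero    = b
  tgt (step {c = c} _ w)     zero    = c
  tgt (step _ w)             (suc j) = tgt w j

  joins-at : ∀ {a l b} (w : Walk a l b) j → Joins (edgeAt w j) (src w j) (tgt w j)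
  joins-at (edge (_ , j))   zero    = j
  joins-at (step (_ , j) w) zero    = j
  joins-at (step _ w)       (suc j) = joins-at w j

  src∈ : ∀ {a l b} (w : Walk a l b) j → src w j ∈ a ∷ l
  src∈ w          zero    = here refl
  src∈ (step _ w) (suc j) = there (src∈ w j)

  tgt∈ : ∀ {a l b} (w : Walk a l b) j → tgt w j ∈ b ∷ l
  tgt∈ (edge _)   zero    = here refl
  tgt∈ (step _ w) zero    = there (here refl)
  tgt∈ (step _ w) (suc j) with tgt∈ w j
  ... | here eq  = here eq
  ... | there t∈ = there (there t∈)

  src-0 : ∀ {a l b} (w : Walk a l b) j → toℕ j ≡ 0 → src w j ≡ a
  src-0 w zero _ = refl

  tgt-last : ∀ {a l b} (w : Walk a l b) j → toℕ j ≡ length l → tgt w j ≡ b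
  tgt-last (edge _)   zero    _  = refl
  tgt-last (step _ w) (suc j) eq = tgt-last w j (suc-injective eq)

  tgt-src : ∀ {a l b} (w : Walk a l b) i j → toℕ j ≡ suc (toℕ i) → tgt w i ≡ src w j
  tgt-src (step _ w) zero    (suc j) eq = ≡-sym (src-0 w j (suc-injective eq))
  tgt-src (step _ w) (suc i) (suc j) eq = tgt-src w i j (suc-injective eq)

  private
    tail-nodup : ∀ {a c b l} → Nodup (a ∷ b ∷ c ∷ l) → Nodup (c ∷ b ∷ l)
    tail-nodup {a} {c} {b} {l} = nodup-⊆ ([ a ] ∷ [ b ] ∷ [ c ] ∷ l ∷ []) (v2 ⊕ v1 ⊕ v3) (v0 ⊕ v1 ⊕ v2 ⊕ v3)

  src-injective : ∀ {a l b} (w : Walk a l b) → Nodup (a ∷ b ∷ l) → ∀ i j → src w i ≡ src w j → i ≡ j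
  src-injective w          n zero    zero    _  = refl
  src-injective (step _ w) n zero    (suc j) eq = ⊥-elim (nodup-head n (there (subst (_∈ _) (≡-sym eq) (src∈ w j))))
  src-injective (step _ w) n (suc i) zero    eq = ⊥-elim (nodup-head n (there (subst (_∈ _) eq (src∈ w i))))
  src-injective (step _ w) n (suc i) (suc j) eq = cong suc (src-injective w (tail-nodup n) i j eq)

  tgt-injective : ∀ {a l b} (w : Walk a l b) → Nodup (a ∷ b ∷ l) → ∀ i j → tgt w i ≡ tgt w j → i ≡ j
  tgt-injective (edge _)   n zero    zero    _  = refl
  tgt-injective (step _ w) n zero    zero    _  = refl
  tgt-injective (step _ w) n zero    (suc j) eq = ⊥-elim (nodup-head (tail-nodup n) (subst (_∈ _) (≡-sym eq) (tgt∈ w j)))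
  tgt-injective (step _ w) n (suc i) zero    eq = ⊥-elim (nodup-head (tail-nodup n) (subst (_∈ _) eq (tgt∈ w i)))
  tgt-injective (step _ w) n (suc i) (suc j) eq = cong suc (tgt-injective w (tail-nodup n) i j eq)

  src≡tgt : ∀ {a l b} (w : Walk a l b) → Nodup (a ∷ b ∷ l) → ∀ i j → src w i ≡ tgt w j → toℕ i ≡ suc (toℕ j)
  src≡tgt w          n zero    j       eq = ⊥-elim (nodup-head n (subst (_∈ _) (≡-sym eq) (tgt∈ w j)))
  src≡tgt (step _ w) n (suc i) zero    eq = cong suc (cong toℕ (src-injective w (tail-nodup n) i zero eq))
  src≡tgt (step _ w) n (suc i) (suc j) eq = cong suc (src≡tgt w (tail-nodup n) i j eq)

  src≡a : ∀ {a l b} (w : Walk a l b) → Nodup (a ∷ b ∷ l) → ∀ i → src w i ≡ a → toℕ i ≡ 0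
  src≡a w n i eq = cong toℕ (src-injective w n i zero eq)

  tgt≡b : ∀ {a l b} (w : Walk a l b) → Nodup (a ∷ b ∷ l) → ∀ i → tgt w i ≡ b → toℕ i ≡ length l
  tgt≡b {l = l} w n i eq = trans (cong toℕ (tgt-injective w n i (fromℕ (length l))
    (trans eq (≡-sym (tgt-last w (fromℕ (length l)) (Fin.toℕ-fromℕ (length l))))))) (Fin.toℕ-fromℕ (length l))

-- The bipartite graph whose edges are the vertices of the trigraph.

module LineGraph (T : Trigraph) {a b : ℕ} (e : V T → Fin a × Fin b) (e-injective : Injective _≡_ _≡_ e)
  (adj⇔ : ∀ u v → u ≢ v → Adj T u v ⇔ (proj₁ (e u) ≡ proj₁ (e v) ⊎ proj₂ (e u) ≡ proj₂ (e v))) where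

  W : Set
  W = Fin a ⊎ Fin b

  _≟_ : DecidableEquality W
  _≟_ = ⊎-≡-dec Fin._≟_ Fin._≟_

  L R : V T → W
  L t = inj₁ (proj₁ (e t))
  R t = inj₂ (proj₂ (e t))

  Joins : V T → W → W → Set
  Joins t u v = (u ≡ L t × v ≡ R t) ⊎ (u ≡ R t × v ≡ L t)

  joins-sym : ∀ {t u v} → Joins t u v → Joins t v u
  joins-sym (inj₁ (p , q)) = inj₂ (q , p)
  joins-sym (inj₂ (p , q)) = inj₁ (q , p)

  E : W → W → Set
  E u v = Σ (V T) λ t → Joins t u v

  E-sym : ∀ {u v} → E u v → E v u
  E-sym (t , j) = t , joins-sym j

  side : W → Bool
  side (inj₁ _) = true
  side (inj₂ _) = false

  E-side : ∀ {u v} → E u v → side v ≡ not (side u)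
  E-side (_ , inj₁ (refl , refl)) = refl
  E-side (_ , inj₂ (refl , refl)) = refl

  open Multiplicity _≟_
  open Walks _≟_ E E-sym
  open Bipartite _≟_ E E-sym side E-side
  open WalkEdges _≟_ Joins joins-sym

  End : V T → W → Set
  End t z = z ≡ L t ⊎ z ≡ R t

  joins-end : ∀ {t u v} → Joins t u v → End t u × End t v
  joins-end (inj₁ (p , q)) = inj₁ p , inj₂ q
  joins-end (inj₂ (p , q)) = inj₂ p , inj₁ q

  end-cases : ∀ {t u v z} → Joins t u v → End t z → z ≡ u ⊎ z ≡ v
  end-cases (inj₁ (refl , refl)) z = z
  end-cases (inj₂ (refl , refl)) z = ⊎-swap z

  other-end : ∀ {t u} → End t u → Σ W λ v → Joins t u v
  other-end {t} (inj₁ eq) = R t , inj₁ (eq , refl)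
  other-end {t} (inj₂ eq) = L t , inj₂ (eq , refl)

  joins-ends : ∀ {t u v} → End t u → End t v → u ≢ v → Joins t u v
  joins-ends (inj₁ refl) (inj₁ refl) ne = ⊥-elim (ne refl)
  joins-ends (inj₁ p)    (inj₂ q)    _  = inj₁ (p , q)
  joins-ends (inj₂ p)    (inj₁ q)    _  = inj₂ (p , q)
  joins-ends (inj₂ refl) (inj₂ refl) ne = ⊥-elim (ne refl)

  joins-functional : ∀ {t u v v′} → Joins t u v → Joins t u v′ → v ≡ v′
  joins-functional (inj₁ (refl , refl)) (inj₁ (_ , refl)) = refl
  joins-functional (inj₂ (refl , refl)) (inj₂ (_ , refl)) = refl
  joins-functional (inj₁ (refl , refl)) (inj₂ (() , _))
  joins-functional (inj₂ (refl , refl)) (inj₁ (() , _))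

  joins-injective : ∀ {t t′ u v} → Joins t u v → Joins t′ u v → t ≡ t′
  joins-injective (inj₁ (p , q)) (inj₁ (p′ , q′)) =
    e-injective (cong₂ _,_ (inj₁-injective (trans (≡-sym p) p′)) (inj₂-injective (trans (≡-sym q) q′)))
  joins-injective (inj₂ (p , q)) (inj₂ (p′ , q′)) =
    e-injective (cong₂ _,_ (inj₁-injective (trans (≡-sym q) q′)) (inj₂-injective (trans (≡-sym p) p′)))
  joins-injective (inj₁ (refl , _)) (inj₂ (() , _))
  joins-injective (inj₂ (refl , _)) (inj₁ (() , _))

  share : ∀ {t t′} → t ≢ t′ → Adj T t t′ → Σ W λ z → End t z × End t′ z
  share {t} {t′} ne adj with to (adj⇔ t t′ ne) adj
  ... | inj₁ eq = L t , inj₁ refl , inj₁ (cong inj₁ eq)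
  ... | inj₂ eq = R t , inj₂ refl , inj₂ (cong inj₂ eq)

  common-end : ∀ {t t′ z} → t ≢ t′ → End t z → End t′ z → Adj T t t′
  common-end {t} {t′} ne (inj₁ p) (inj₁ q) = from (adj⇔ t t′ ne) (inj₁ (inj₁-injective (trans (≡-sym p) q)))
  common-end {t} {t′} ne (inj₂ p) (inj₂ q) = from (adj⇔ t t′ ne) (inj₂ (inj₂-injective (trans (≡-sym p) q)))
  common-end ne (inj₁ refl) (inj₂ ())
  common-end ne (inj₂ refl) (inj₁ ())

  -- Odd prisms from same-side thetas.

  module ThetaPrism {p q : W} (ls : Fin 3 → List W) (ws : ∀ i → Walk p (ls i) q)
    (nd : ∀ i → Nodup (p ∷ q ∷ ls i)) (disjoint : ∀ {i j x} → i ≢ j → x ∈ ls i → x ∉ ls j)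
    (odd : ∀ i → Odd (length (ls i))) where

    -- A path with `m i` interior vertices has `suc (m i)` edges, which are the positions on a rung
    -- of length `m i`.
    m : Fin 3 → ℕ
    m i = length (ls i)

    f : PrismIndex T m → V T
    f (i , j) = edgeAt (ws i) j

    private
      p≢q : p ≢ q
      p≢q eq = nodup-head (nd zero) (here eq)
      p∉ : ∀ i → p ∉ ls i
      p∉ i p∈ = nodup-head (nd i) (there p∈)
      q∉ : ∀ i → q ∉ ls i
      q∉ i = nodup-head (nodup-⊆ ([ p ] ∷ [ q ] ∷ ls i ∷ []) (v1 ⊕ v2) (v0 ⊕ v1 ⊕ v2) (nd i))

      1≤m : ∀ i → 1 ≤ m i
      1≤m i with length (ls i) | odd i
      ... | suc _ | _ = s≤s z≤n

      S Tg : PrismIndex T m → W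
      S (i , j) = src (ws i) j
      Tg (i , j) = tgt (ws i) j

      joins : ∀ s → Joins (f s) (S s) (Tg s)
      joins (i , j) = joins-at (ws i) j

      src-src : ∀ {i i′} j j′ → i ≢ i′ → S (i , j) ≡ S (i′ , j′) → toℕ j ≡ 0 × toℕ j′ ≡ 0
      src-src {i} {i′} j j′ ne eq with src∈ (ws i) j | src∈ (ws i′) j′
      ... | here a   | _        = src≡a (ws i) (nd i) j a , src≡a (ws i′) (nd i′) j′ (trans (≡-sym eq) a)
      ... | there a  | here b   = ⊥-elim (p∉ i (subst (_∈ ls i) (trans eq b) a))
      ... | there a  | there b  = ⊥-elim (disjoint ne a (subst (_∈ ls i′) (≡-sym eq) b))

      tgt-tgt : ∀ {i i′} j j′ → i ≢ i′ → Tg (i , j) ≡ Tg (i′ , j′) → toℕ j ≡ m i × toℕ j′ ≡ m i′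
      tgt-tgt {i} {i′} j j′ ne eq with tgt∈ (ws i) j | tgt∈ (ws i′) j′
      ... | here a   | _        = tgt≡b (ws i) (nd i) j a , tgt≡b (ws i′) (nd i′) j′ (trans (≡-sym eq) a)
      ... | there a  | here b   = ⊥-elim (q∉ i (subst (_∈ ls i) (trans eq b) a))
      ... | there a  | there b  = ⊥-elim (disjoint ne a (subst (_∈ ls i′) (≡-sym eq) b))

      src-tgt : ∀ {i i′} j j′ → i ≢ i′ → S (i , j) ≢ Tg (i′ , j′)
      src-tgt {i} {i′} j j′ ne eq with src∈ (ws i) j | tgt∈ (ws i′) j′
      ... | here a   | here b   = p≢q (trans (≡-sym a) (trans eq b))
      ... | here a   | there b  = p∉ i′ (subst (_∈ ls i′) (trans (≡-sym eq) a) b)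
      ... | there a  | here b   = q∉ i (subst (_∈ ls i) (trans eq b) a)
      ... | there a  | there b  = disjoint ne a (subst (_∈ ls i′) (≡-sym eq) b)

      Sh : PrismIndex T m → PrismIndex T m → Set
      Sh s t = S s ≡ S t ⊎ S s ≡ Tg t ⊎ Tg s ≡ S t ⊎ Tg s ≡ Tg t

      -- Distinct edges of one path meet only head to tail and are then consecutive. Edges of
      -- different paths meet only at `p` or at `q`, where the three edges form a triangle.
      prism-edge : ∀ s t → s ≢ t → Sh s t → PrismEdge T m s t
      prism-edge (i , j) (i′ , j′) s≢t sh with i Fin.≟ i′ | sh
      ... | yes refl | inj₁ eq = ⊥-elim (s≢t (cong (i ,_) (src-injective (ws i) (nd i) j j′ eq)))
      ... | yes refl | inj₂ (inj₁ eq) = inj₁ (refl , inj₂ (src≡tgt (ws i) (nd i) j j′ eq))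
      ... | yes refl | inj₂ (inj₂ (inj₁ eq)) = inj₁ (refl , inj₁ (src≡tgt (ws i) (nd i) j′ j (≡-sym eq)))
      ... | yes refl | inj₂ (inj₂ (inj₂ eq)) = ⊥-elim (s≢t (cong (i ,_) (tgt-injective (ws i) (nd i) j j′ eq)))
      ... | no ne | inj₁ eq = inj₂ (inj₁ (ne , src-src j j′ ne eq))
      ... | no ne | inj₂ (inj₁ eq) = ⊥-elim (src-tgt j j′ ne eq)
      ... | no ne | inj₂ (inj₂ (inj₁ eq)) = ⊥-elim (src-tgt j′ j (λ a → ne (≡-sym a)) (≡-sym eq))
      ... | no ne | inj₂ (inj₂ (inj₂ eq)) = inj₂ (inj₂ (ne , tgt-tgt j j′ ne eq))

      shared : ∀ s t → PrismEdge T m s t → Sh s t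
      shared (i , j) (_ , j′) (inj₁ (refl , inj₁ eq)) = inj₂ (inj₂ (inj₁ (tgt-src (ws i) j j′ eq)))
      shared (i , j) (_ , j′) (inj₁ (refl , inj₂ eq)) = inj₂ (inj₁ (≡-sym (tgt-src (ws i) j′ j eq)))
      shared (i , j) (i′ , j′) (inj₂ (inj₁ (_ , eq , eq′))) =
        inj₁ (trans (src-0 (ws i) j eq) (≡-sym (src-0 (ws i′) j′ eq′)))
      shared (i , j) (i′ , j′) (inj₂ (inj₂ (_ , eq , eq′))) =
        inj₂ (inj₂ (inj₂ (trans (tgt-last (ws i) j eq) (≡-sym (tgt-last (ws i′) j′ eq′)))))

      0≢m : ∀ i {k} → k ≡ 0 → k ≢ m i
      0≢m i refl eq with m i | 1≤m i
      0≢m i refl () | suc _ | _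

      f-injective : ∀ s t → f s ≡ f t → s ≡ t
      f-injective s@(i , j) t@(i′ , j′) eq with i Fin.≟ i′
        | end-cases (joins s) (subst (λ x → End x (S t)) (≡-sym eq) (proj₁ (joins-end (joins t))))
        | end-cases (joins s) (subst (λ x → End x (Tg t)) (≡-sym eq) (proj₂ (joins-end (joins t))))
      ... | yes refl | inj₁ a | _ = cong (i ,_) (≡-sym (src-injective (ws i) (nd i) j′ j a))
      ... | yes refl | inj₂ _ | inj₂ b = cong (i ,_) (≡-sym (tgt-injective (ws i) (nd i) j′ j b))
      -- One edge traversed in both directions would stand at positions `j` and `j + 2` at once.
      ... | yes refl | inj₂ a | inj₁ b = ⊥-elim (m≢1+n+m (toℕ j) {1} (trans (src≡tgt (ws i) (nd i) j j′ (≡-sym b))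
                                                   (cong suc (src≡tgt (ws i) (nd i) j′ j a))))
      ... | no ne | inj₂ a | _ = ⊥-elim (src-tgt j′ j (λ x → ne (≡-sym x)) a)
      ... | no ne | inj₁ a | inj₁ b = ⊥-elim (src-tgt j j′ ne (≡-sym b))
      -- An edge on two different paths would join `p` to `q` and be both first and last on its
      -- path, against `1≤m`.
      ... | no ne | inj₁ a | inj₂ b = ⊥-elim (0≢m i (proj₁ (src-src j j′ ne (≡-sym a))) (proj₁ (tgt-tgt j j′ ne (≡-sym b))))

      adj-shared : ∀ s t → s ≢ t → Adj T (f s) (f t) → Sh s t
      adj-shared s t ne adj with share (λ eq → ne (f-injective s t eq)) adj
      ... | z , z∈s , z∈t with end-cases (joins s) z∈s | end-cases (joins t) z∈t
      ... | inj₁ refl | inj₁ eq = inj₁ eq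
      ... | inj₁ refl | inj₂ eq = inj₂ (inj₁ eq)
      ... | inj₂ refl | inj₁ eq = inj₂ (inj₂ (inj₁ eq))
      ... | inj₂ refl | inj₂ eq = inj₂ (inj₂ (inj₂ eq))

      shared-adj : ∀ s t → s ≢ t → Sh s t → Adj T (f s) (f t)
      shared-adj s t ne sh with joins-end (joins s) | joins-end (joins t) | (λ eq → ne (f-injective s t eq)) | sh
      ... | a , _ | b , _ | ft | inj₁ eq = common-end ft a (subst (End (f t)) (≡-sym eq) b)
      ... | a , _ | _ , b | ft | inj₂ (inj₁ eq) = common-end ft a (subst (End (f t)) (≡-sym eq) b)
      ... | _ , a | b , _ | ft | inj₂ (inj₂ (inj₁ eq)) = common-end ft a (subst (End (f t)) (≡-sym eq) b)
      ... | _ , a | _ , b | ft | inj₂ (inj₂ (inj₂ eq)) = common-end ft a (subst (End (f t)) (≡-sym eq) b)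

    oddPrism : ContainsOddPrism T
    oddPrism = m , f , (1≤m , (λ {s} {t} → f-injective s t)
      , λ s t ne → mk⇔ (λ adj → prism-edge s t ne (adj-shared s t ne adj))
                       (λ pe → shared-adj s t ne (shared s t pe))) , odd

  noTheta : ¬ ContainsOddPrism T → NoTheta
  noTheta ¬prism {p} {q} {l₁} {l₂} {l₃} eq w₁ w₂ w₃ n = ¬prism (ThetaPrism.oddPrism ls ws nd disj odd)
    where
    ρ = [ p ] ∷ [ q ] ∷ l₁ ∷ l₂ ∷ l₃ ∷ []
    all : Expr 5
    all = v0 ⊕ v1 ⊕ v2 ⊕ v3 ⊕ v4
    ls : Fin 3 → List W
    ls zero             = l₁
    ls (suc zero)       = l₂
    ls (suc (suc zero)) = l₃
    ws : ∀ i → Walk p (ls i) q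
    ws zero             = w₁
    ws (suc zero)       = w₂
    ws (suc (suc zero)) = w₃
    nd : ∀ i → Nodup (p ∷ q ∷ ls i)
    nd zero             = nodup-⊆ ρ (v0 ⊕ v1 ⊕ v2) all n
    nd (suc zero)       = nodup-⊆ ρ (v0 ⊕ v1 ⊕ v3) all n
    nd (suc (suc zero)) = nodup-⊆ ρ (v0 ⊕ v1 ⊕ v4) all n
    disj : ∀ {i j x} → i ≢ j → x ∈ ls i → x ∉ ls j
    disj {zero}           {zero}           ne = ⊥-elim (ne refl)
    disj {zero}           {suc zero}       _  = nodup-disjoint l₁ (nodup-⊆ ρ (v2 ⊕ v3) all n)
    disj {zero}           {suc (suc zero)} _  = nodup-disjoint l₁ (nodup-⊆ ρ (v2 ⊕ v4) all n)
    disj {suc zero}       {zero}           _  = nodup-disjoint l₂ (nodup-⊆ ρ (v3 ⊕ v2) all n)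
    disj {suc zero}       {suc zero}       ne = ⊥-elim (ne refl)
    disj {suc zero}       {suc (suc zero)} _  = nodup-disjoint l₂ (nodup-⊆ ρ (v3 ⊕ v4) all n)
    disj {suc (suc zero)} {zero}           _  = nodup-disjoint l₃ (nodup-⊆ ρ (v4 ⊕ v2) all n)
    disj {suc (suc zero)} {suc zero}       _  = nodup-disjoint l₃ (nodup-⊆ ρ (v4 ⊕ v3) all n)
    disj {suc (suc zero)} {suc (suc zero)} ne = ⊥-elim (ne refl)
    odd : ∀ i → Odd (length (ls i))
    odd i = walk-odd (ws i) eq

  -- From paths of the trigraph to walks of the bipartite graph.

  module InducedPaths (apart : ∀ {c d z} → c ≢ d → Semiadj T c d → z ≢ c → z ≢ d → Adj T c z → Adj T d z → ⊥) where

    -- The edge c has only two ends, so two of its three neighbours meet it at the same one.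
    claw : ∀ {c z₁ z₂ z₃} → z₁ ≢ c → z₂ ≢ c → z₃ ≢ c → z₁ ≢ z₂ → z₁ ≢ z₃ → z₂ ≢ z₃ →
           Adj T c z₁ → Adj T c z₂ → Adj T c z₃ → Adj T z₁ z₂ ⊎ Adj T z₁ z₃ ⊎ Adj T z₂ z₃
    claw {c} c₁ c₂ c₃ n₁₂ n₁₃ n₂₃ a₁ a₂ a₃
      with share (λ eq → c₁ (≡-sym eq)) a₁ | share (λ eq → c₂ (≡-sym eq)) a₂ | share (λ eq → c₃ (≡-sym eq)) a₃
    ... | _ , inj₁ refl , e₁ | _ , inj₁ refl , e₂ | _                  = inj₁ (common-end n₁₂ e₁ e₂)
    ... | _ , inj₂ refl , e₁ | _ , inj₂ refl , e₂ | _                  = inj₁ (common-end n₁₂ e₁ e₂)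
    ... | _ , inj₁ refl , e₁ | _ , inj₂ refl , _  | _ , inj₁ refl , e₃ = inj₂ (inj₁ (common-end n₁₃ e₁ e₃))
    ... | _ , inj₁ refl , _  | _ , inj₂ refl , e₂ | _ , inj₂ refl , e₃ = inj₂ (inj₂ (common-end n₂₃ e₂ e₃))
    ... | _ , inj₂ refl , _  | _ , inj₁ refl , e₂ | _ , inj₁ refl , e₃ = inj₂ (inj₂ (common-end n₂₃ e₂ e₃))
    ... | _ , inj₂ refl , e₁ | _ , inj₁ refl , _  | _ , inj₂ refl , e₃ = inj₂ (inj₁ (common-end n₁₃ e₁ e₃))

    semi : ∀ {u v} → Adj T u v → Anti T u v → Semiadj T u v
    semi {u} {v} adj anti with θ T u v
    ... | minus = ⊥-elim (adj refl)
    ... | zer   = refl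
    ... | plus  = ⊥-elim (anti refl)

    adj-sym : ∀ {u v} → Adj T u v → Adj T v u
    adj-sym {u} {v} adj eq = adj (trans (sym T u v) eq)

    Far : ∀ {m} → (Fin (suc m) → V T) → Set
    Far p = ∀ i j → suc (toℕ i) < toℕ j → StronglyAnti T (p i) (p j)

    -- Suppose that two nonconsecutive vertices of the path are semiadjacent. By `ends` one of them
    -- has two neighbours on the path; these and the other vertex of the pair are three neighbours
    -- to which `claw` applies.
    path-far : ∀ {m p} → IsPath T m p → StronglyAnti T (p zero) (p (fromℕ m)) → Far p
    path-far {m} {p} (inj , adj , anti) ends i j i<j with θ T (p i) (p j) in eq
    ... | minus = refl
    ... | plus  = ⊥-elim (anti i j i<j eq)
    ... | zer   = ⊥-elim (cases (toℕ i) (toℕ j) refl refl (<-cmp (toℕ j) m))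
      where
      distinct : ∀ {x y} → toℕ x ≢ toℕ y → p x ≢ p y
      distinct ne eq = ne (cong toℕ (inj eq))
      -- Each outcome of `claw` contradicts `apart`: if `k⁻` and `k⁺` are adjacent, they are
      -- semiadjacent with common neighbour `k`; otherwise `k⁻` or `k⁺` is a common neighbour of the
      -- semiadjacent `k` and `d`.
      noClaw : ∀ k k⁻ k⁺ d → toℕ k ≡ suc (toℕ k⁻) → toℕ k⁺ ≡ suc (toℕ k) →
               toℕ d ≢ toℕ k → toℕ d ≢ toℕ k⁻ → toℕ d ≢ toℕ k⁺ → Semiadj T (p k) (p d) → ⊥
      noClaw k k⁻ k⁺ d k≡ k⁺≡ d≢k d≢k⁻ d≢k⁺ sm
        with claw (distinct k⁻≢k) (distinct k⁺≢k) (distinct d≢k) (distinct k⁻≢k⁺)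
               (distinct (λ a → d≢k⁻ (≡-sym a))) (distinct (λ a → d≢k⁺ (≡-sym a)))
               (adj-sym (adj k⁻ k k≡)) (adj k k⁺ k⁺≡) (λ a → semi≢minus (trans (≡-sym sm) a))
        where
        semi≢minus : zer ≢ minus
        semi≢minus ()
        k⁻≢k : toℕ k⁻ ≢ toℕ k
        k⁻≢k a = m≢1+n+m (toℕ k⁻) {0} (trans a k≡)
        k⁺≢k : toℕ k⁺ ≢ toℕ k
        k⁺≢k a = m≢1+n+m (toℕ k) {0} (trans (≡-sym a) k⁺≡)
        k⁻≢k⁺ : toℕ k⁻ ≢ toℕ k⁺
        k⁻≢k⁺ a = m≢1+n+m (toℕ k⁻) {1} (trans a (trans k⁺≡ (cong suc k≡)))
      ... | inj₁ a = apart (distinct λ b → m≢1+n+m (toℕ k⁻) {1} (trans b (trans k⁺≡ (cong suc k≡))))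
                       (semi a (anti k⁻ k⁺ (≤-reflexive (≡-sym (trans k⁺≡ (cong suc k≡))))))
                       (distinct λ b → m≢1+n+m (toℕ k⁻) {0} (trans (≡-sym b) k≡))
                       (distinct λ b → m≢1+n+m (toℕ k) {0} (trans b k⁺≡))
                       (adj k⁻ k k≡) (adj-sym (adj k k⁺ k⁺≡))
      ... | inj₂ (inj₁ a) = apart (distinct (λ b → d≢k (≡-sym b))) sm
                       (distinct λ b → m≢1+n+m (toℕ k⁻) {0} (trans b k≡)) (distinct (λ b → d≢k⁻ (≡-sym b)))
                       (adj-sym (adj k⁻ k k≡)) (adj-sym a)
      ... | inj₂ (inj₂ a) = apart (distinct (λ b → d≢k (≡-sym b))) sm
                       (distinct λ b → m≢1+n+m (toℕ k) {0} (trans (≡-sym b) k⁺≡)) (distinct (λ b → d≢k⁺ (≡-sym b)))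
                       (adj k k⁺ k⁺≡) (adj-sym a)
      -- The centre of the claw is position `i` unless it is the first, and then `j` unless it is
      -- the last; the remaining case is `ends`.
      cases : ∀ n k → n ≡ toℕ i → k ≡ toℕ j → Tri (toℕ j < m) (toℕ j ≡ m) (m < toℕ j) → ⊥
      cases _ _ _ _ (tri> _ _ m<j) = <-irrefl refl (≤-trans (Fin.toℕ<n j) m<j)
      cases zero _ i≡ _ (tri≈ _ j≡ _) with trans (≡-sym eq) (trans (cong₂ (λ x y → θ T (p x) (p y))
          (Fin.toℕ-injective {i = i} {j = zero} (≡-sym i≡)) (Fin.toℕ-injective (trans j≡ (≡-sym (Fin.toℕ-fromℕ m))))) ends)
      ... | ()
      cases (suc n) _ i≡ _ _ = noClaw i (fromℕ< n<) (fromℕ< i⁺<) j (trans (≡-sym i≡) (cong suc (≡-sym (Fin.toℕ-fromℕ< n<))))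
          (Fin.toℕ-fromℕ< i⁺<) (λ a → <-irrefl (≡-sym a) (≤-trans (n≤1+n _) i<j))
          (λ a → <-irrefl (trans (≡-sym (Fin.toℕ-fromℕ< n<)) (≡-sym a)) (≤-trans (≤-trans (≤-reflexive i≡) (n≤1+n _)) (≤-trans (n≤1+n _) i<j)))
          (λ a → <-irrefl (≡-sym (trans a (Fin.toℕ-fromℕ< i⁺<))) i<j) eq
        where
        n< : n < suc m
        n< = ≤-trans (≤-reflexive i≡) (≤-trans (n≤1+n _) (Fin.toℕ<n i))
        i⁺< : suc (toℕ i) < suc m
        i⁺< = <-trans i<j (Fin.toℕ<n j)
      cases zero zero _ j≡ _ = <-irrefl j≡ (≤-trans (s≤s z≤n) i<j)
      cases zero (suc n) i≡ j≡ (tri< j<m _ _) = noClaw j (fromℕ< n<) (fromℕ< j⁺<) i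
          (trans (≡-sym j≡) (cong suc (≡-sym (Fin.toℕ-fromℕ< n<)))) (Fin.toℕ-fromℕ< j⁺<)
          (λ a → <-irrefl a (≤-trans (n≤1+n _) i<j)) (λ a → <-irrefl (trans a (Fin.toℕ-fromℕ< n<)) i<n)
          (λ a → <-irrefl (trans a (Fin.toℕ-fromℕ< j⁺<)) (≤-trans (≤-trans (n≤1+n _) i<j) (n≤1+n _)))
          (trans (sym T (p j) (p i)) eq)
        where
        i<n : toℕ i < n
        i<n = s≤s⁻¹ (≤-trans i<j (≤-reflexive (≡-sym j≡)))
        n< : n < suc m
        n< = ≤-trans (≤-reflexive j≡) (≤-trans (n≤1+n _) (Fin.toℕ<n j))
        j⁺< : suc (toℕ j) < suc m
        j⁺< = s≤s j<m

    -- Consecutive edges of an induced path share ends, which form a walk.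
    trace : ∀ m (p : Fin (3 + m) → V T) → (∀ {i j} → p i ≡ p j → i ≡ j) →
      (∀ i j → toℕ j ≡ suc (toℕ i) → Adj T (p i) (p j)) → Far p →
      ∀ {u} → End (p zero) u → End (p (suc zero)) u →
      Σ W λ u′ → Σ (List W) λ l → Walk u l u′ × length l ≡ m × End (p (fromℕ (2 + m))) u′
        × (∀ {x} → x ∈ l → (Σ (Fin (3 + m)) λ i → 2 ≤ toℕ i × End (p i) x) × (Σ (Fin (3 + m)) λ i → toℕ i ≤ m × End (p i) x))
    trace m p inj adj far {u} u₀ u₁ with share (λ eq → 1≢2 (inj eq)) (adj (suc zero) (suc (suc zero)) refl)
      where
      1≢2 : _≢_ {A = Fin (3 + m)} (suc zero) (suc (suc zero))
      1≢2 ()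
    ... | c , c₁ , c₂ = extend m p inj adj far u₁ c₁ c₂
      where
      0≢2 : _≢_ {A = Fin (3 + m)} zero (suc (suc zero))
      0≢2 ()
      u≢c : u ≢ c
      u≢c refl = common-end (λ eq → 0≢2 (inj eq)) u₀ c₂ (far zero (suc (suc zero)) (s≤s (s≤s z≤n)))
      extend : ∀ m (p : Fin (3 + m) → V T) → (∀ {i j} → p i ≡ p j → i ≡ j) →
        (∀ i j → toℕ j ≡ suc (toℕ i) → Adj T (p i) (p j)) → Far p →
        End (p (suc zero)) u → End (p (suc zero)) c → End (p (suc (suc zero))) c →
        Σ W λ u′ → Σ (List W) λ l → Walk u l u′ × length l ≡ m × End (p (fromℕ (2 + m))) u′
          × (∀ {x} → x ∈ l → (Σ (Fin (3 + m)) λ i → 2 ≤ toℕ i × End (p i) x) × (Σ (Fin (3 + m)) λ i → toℕ i ≤ m × End (p i) x))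
      extend zero p inj adj far u₁ c₁ c₂ = c , [] , edge (p (suc zero) , joins-ends u₁ c₁ u≢c) , refl , c₂ , λ ()
      extend (suc m) p inj adj far u₁ c₁ c₂
        with trace m (λ i → p (suc i)) (λ eq → Fin.suc-injective (inj eq)) (λ i j eq → adj (suc i) (suc j) (cong suc eq))
               (λ i j i<j → far (suc i) (suc j) (s≤s i<j)) c₁ c₂
      ... | u′ , l , w , len , end , interior =
        u′ , c ∷ l , step (p (suc zero) , joins-ends u₁ c₁ u≢c) w , cong suc len , end
        , λ { (here refl) → (suc (suc zero) , s≤s (s≤s z≤n) , c₂) , (suc zero , s≤s z≤n , c₁)
            ; (there x∈) → let (i , 2≤i , eᵢ) , (j , j≤m , eⱼ) = interior x∈
                           in (suc i , ≤-trans 2≤i (n≤1+n _) , eᵢ) , (suc j , s≤s j≤m , eⱼ) }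

    -- An odd path of length at least three, say `2 + n`, traces a walk with `n` interior vertices.
    -- As `n` is odd, the walk joins ends of `u` and `v` on the same side, and it avoids their other
    -- ends; this is what the two hypotheses forbid.
    evenPair : ∀ {u v} → u ≢ v → StronglyAnti T u v →
      (∀ {l} → Walk (L u) l (L v) → R u ∉ l → R v ∉ l → ⊥) →
      (∀ {l} → Walk (R u) l (R v) → L u ∉ l → L v ∉ l → ⊥) → IsEvenPair T u v
    evenPair {u} {v} u≢v anti noL noR = u≢v , anti , even
      where
      even : ∀ m (p : Fin (suc m) → V T) → IsPath T m p → p zero ≡ u → p (fromℕ m) ≡ v → Even m
      even m p path p₀ pₘ with parity m
      ... | inj₁ ev = ev
      even (suc zero) p (_ , adj , _) p₀ pₘ | inj₂ _ =
        ⊥-elim (adj zero (suc zero) refl (trans (cong₂ (θ T) p₀ pₘ) anti))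
      even (suc (suc n)) p path@(inj , adj , _) refl refl | inj₂ (odd-suc (even-suc od)) =
        ⊥-elim (contra (share (λ eq → 0≢1 (inj eq)) (adj zero (suc zero) refl)))
        where
        far : Far p
        far = path-far path anti
        0≢1 : _≢_ {A = Fin (3 + n)} zero (suc zero)
        0≢1 ()
        last = fromℕ (suc (suc n))
        contra : Σ W (λ z → End u z × End (p (suc zero)) z) → ⊥
        contra (z , z₀ , z₁) with trace n p inj adj far z₀ z₁
        ... | z′ , l , w , refl , zₘ , interior = sides z₀ zₘ w (odd-interior od w)
          where
          -- An interior vertex of the walk is an end of some `p i` with `2 ≤ i`, which is strongly
          -- antiadjacent to `p zero` and so shares no end with it.
          ∉₀ : ∀ {x} → End (p zero) x → x ∉ l
          ∉₀ e₀ x∈ with proj₁ (interior x∈)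
          ... | i , 2≤i , eᵢ = common-end (λ eq → 0≢i (cong toℕ (inj eq))) e₀ eᵢ (far zero i 2≤i)
            where
            0≢i : 0 ≢ toℕ i
            0≢i eq = <-irrefl eq (≤-trans (s≤s z≤n) 2≤i)
          ∉ₘ : ∀ {x} → End (p last) x → x ∉ l
          ∉ₘ eₘ x∈ with proj₂ (interior x∈)
          ... | i , i≤ , eᵢ = common-end (λ eq → <-irrefl (cong toℕ (inj eq)) (≤-trans (n≤1+n _) i<m)) eᵢ eₘ (far i last i<m)
            where
            i<m : suc (toℕ i) < toℕ last
            i<m = ≤-trans (s≤s (s≤s i≤)) (≤-reflexive (≡-sym (Fin.toℕ-fromℕ _)))
          sides : ∀ {z z′} → End u z → End v z′ → Walk z l z′ → side z ≡ side z′ → ⊥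
          sides (inj₁ refl) (inj₁ refl) w _ = noL w (∉₀ (inj₂ refl)) (∉ₘ (inj₂ refl))
          sides (inj₂ refl) (inj₂ refl) w _ = noR w (∉₀ (inj₁ refl)) (∉ₘ (inj₁ refl))
          sides (inj₁ refl) (inj₂ refl) _ ()
          sides (inj₂ refl) (inj₁ refl) _ ()

    noGoodPair : {A : V T → Set} {Av : W → Set} → (∀ {t t′} → A t → A t′ → ¬ IsEvenPair T t t′) →
      (∀ {t u v} → Joins t u v → Av u → Av v → A t) →
      ∀ {u v x y} → E u v → E x y → side u ≡ side x → u ≢ x → v ≢ y → Av u → Av v → Av x → Av y →
      (∀ {k} → Walk v k y → u ∉ k → x ∉ k → ⊥) → (∀ {k} → Walk u k x → v ∉ k → y ∉ k → ⊥) → ⊥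
    noGoodPair noPair A-of (t , j) (t′ , j′) eq u≢x v≢y au av ax ay b₁ b₂ = go j j′ eq
      where
      pair : IsEvenPair T t t′ → ⊥
      pair = noPair (A-of j au av) (A-of j′ ax ay)
      anti : t ≢ t′ → (∀ {z} → End t z → End t′ z → ⊥) → StronglyAnti T t t′
      anti ne ¬z with θ T t t′ in eq
      ... | minus = refl
      ... | zer   = ⊥-elim (let _ , a , b = share ne (λ eq′ → case trans (≡-sym eq) eq′ of λ ()) in ¬z a b)
      ... | plus  = ⊥-elim (let _ , a , b = share ne (λ eq′ → case trans (≡-sym eq) eq′ of λ ()) in ¬z a b)
      go : Joins t _ _ → Joins t′ _ _ → _ → ⊥
      go (inj₁ (refl , refl)) (inj₁ (refl , refl)) _ =
        pair (evenPair (λ { refl → u≢x refl }) (anti (λ { refl → u≢x refl })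
          λ { (inj₁ refl) (inj₁ a) → u≢x a ; (inj₂ refl) (inj₂ a) → v≢y a ; (inj₁ refl) (inj₂ ()) ; (inj₂ refl) (inj₁ ()) }) b₂ b₁)
      go (inj₂ (refl , refl)) (inj₂ (refl , refl)) _ =
        pair (evenPair (λ { refl → u≢x refl }) (anti (λ { refl → u≢x refl })
          λ { (inj₁ refl) (inj₁ a) → v≢y a ; (inj₂ refl) (inj₂ a) → u≢x a ; (inj₁ refl) (inj₂ ()) ; (inj₂ refl) (inj₁ ()) }) b₁ b₂)
      go (inj₁ (refl , refl)) (inj₂ (refl , refl)) ()
      go (inj₂ (refl , refl)) (inj₁ (refl , refl)) ()

-- Decidability of even pairs, which permits arguing by contradiction.

_≟Θ_ : DecidableEquality Θ
minus ≟Θ minus = yes refl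
minus ≟Θ zer   = no λ ()
minus ≟Θ plus  = no λ ()
zer   ≟Θ minus = no λ ()
zer   ≟Θ zer   = yes refl
zer   ≟Θ plus  = no λ ()
plus  ≟Θ minus = no λ ()
plus  ≟Θ zer   = no λ ()
plus  ≟Θ plus  = yes refl

odd⇒¬even : ∀ {n} → Odd n → ¬ Even n
odd⇒¬even (odd-suc ev) (even-suc od) = odd⇒¬even od ev

even? : ∀ n → Dec (Even n)
even? n with parity n
... | inj₁ ev = yes ev
... | inj₂ od = no (odd⇒¬even od)

module Decidability (T : Trigraph) where

  adj? : ∀ u v → Dec (Adj T u v)
  adj? u v = ¬? (θ T u v ≟Θ minus)

  inD? : ∀ z → Dec (InD T z)
  inD? z = Fin.any? λ w → ¬? (w Fin.≟ z) ×-dec (θ T z w ≟Θ zer)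

  isPath? : ∀ m p → Dec (IsPath T m p)
  isPath? m p =
    map′ (λ f {i} {j} → f i j) (λ f i j → f) (Fin.all? λ i → Fin.all? λ j → (p i Fin.≟ p j) →-dec (i Fin.≟ j))
    ×-dec (Fin.all? λ i → Fin.all? λ j → (toℕ j ≟ℕ suc (toℕ i)) →-dec adj? (p i) (p j))
    ×-dec (Fin.all? λ i → Fin.all? λ j → (suc (toℕ i) <? toℕ j) →-dec ¬? (θ T (p i) (p j) ≟Θ plus))

  -- Decoding the code of a path returns a function that agrees with it only pointwise.
  isPath-≗ : ∀ {m p p′} → p ≗ p′ → IsPath T m p → IsPath T m p′
  isPath-≗ {p = p} {p′} p≗p′ (inj , adj , anti) =
      (λ eq → inj (trans (p≗p′ _) (trans eq (≡-sym (p≗p′ _)))))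
    , (λ i j eq → subst id (cong₂ (Adj T) (p≗p′ i) (p≗p′ j)) (adj i j eq))
    , (λ i j lt → subst id (cong₂ (Anti T) (p≗p′ i) (p≗p′ j)) (anti i j lt))

  -- Paths have fewer than n T edges, so they are enumerated by the codes of functions Fin (suc m) → Fin (n T).
  isEvenPair? : ∀ u v → Dec (IsEvenPair T u v)
  isEvenPair? u v = ¬? (u Fin.≟ v) ×-dec (θ T u v ≟Θ minus) ×-dec
    map′ enough (λ f m k → f (toℕ m) (finToFun k)) (Fin.all? λ (m : V T) → Fin.all? λ k → evenIfPath? (toℕ m) (finToFun k))
    where
    EvenIfPath : ∀ m → (Fin (suc m) → V T) → Set
    EvenIfPath m p = IsPath T m p → p zero ≡ u → p (fromℕ m) ≡ v → Even m
    evenIfPath? : ∀ m p → Dec (EvenIfPath m p)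
    evenIfPath? m p = isPath? m p →-dec ((p zero Fin.≟ u) →-dec ((p (fromℕ m) Fin.≟ v) →-dec even? m))
    enough : (∀ (m : V T) k → EvenIfPath (toℕ m) (finToFun k)) → ∀ m p → EvenIfPath m p
    enough f m p path p₀ pₘ = decode (fromℕ< m<n) (Fin.toℕ-fromℕ< m<n) (≡-sym ∘ Fin.finToFun-funToFin p)
      where
      m<n : m < n T
      m<n = Fin.injective⇒≤ (proj₁ path)
      decode : ∀ (m′ : V T) → toℕ m′ ≡ m → p ≗ finToFun (funToFin p) → Even m
      decode m′ refl code = f m′ (funToFin p) (isPath-≗ code path) (trans (≡-sym (code _)) p₀) (trans (≡-sym (code _)) pₘ)

  hasEvenPair? : Dec (HasEvenPair T)
  hasEvenPair? = Fin.any? λ u → Fin.any? λ v → isEvenPair? u v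

  hasDisjointEvenPair? : Dec (Σ (V T) λ u → Σ (V T) λ v → IsEvenPair T u v × ¬ InD T u × ¬ InD T v)
  hasDisjointEvenPair? = Fin.any? λ u → Fin.any? λ v → isEvenPair? u v ×-dec ¬? (inD? u) ×-dec ¬? (inD? v)

-- For a small component this is the disjointness of the two neighbourhoods. In a light one every
-- semiadjacent pair contains `v`, whose only neighbours `x` and `y` are strongly antiadjacent.
semiadjacent-apart : ∀ T → NoSwitchable T ⊎ SmallComponent T ⊎ LightComponent T →
  ∀ {c d z} → c ≢ d → Semiadj T c d → z ≢ c → z ≢ d → Adj T c z → Adj T d z → ⊥
semiadjacent-apart T (inj₁ none) c≢d s _ _ _ _ = none _ _ c≢d s
semiadjacent-apart T (inj₂ (inj₁ (x , y , _ , _ , only , apart))) c≢d s z≢c z≢d a b with only _ _ c≢d s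
... | inj₁ (refl , refl) = apart _ ((z≢c , a) , (z≢d , b))
... | inj₂ (refl , refl) = apart _ ((z≢d , b) , (z≢c , a))
semiadjacent-apart T (inj₂ (inj₂ (v , x , y , _ , _ , _ , _ , _ , only , anti , xy , _))) {z = z} c≢d s z≢c z≢d a b
  with only _ _ c≢d s
... | inj₁ (refl , refl) with z Fin.≟ y
...   | yes refl = b xy
...   | no z≢y   = a (anti z z≢c z≢d z≢y)
semiadjacent-apart T (inj₂ (inj₂ (v , x , y , _ , _ , _ , _ , _ , only , anti , xy , _))) {z = z} c≢d s z≢c z≢d a b
    | inj₂ (inj₁ (refl , refl)) with z Fin.≟ y
...   | yes refl = a xy
...   | no z≢y   = b (anti z z≢d z≢c z≢y)
semiadjacent-apart T (inj₂ (inj₂ (v , x , y , _ , _ , _ , _ , _ , only , anti , xy , _))) {z = z} c≢d s z≢c z≢d a b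
    | inj₂ (inj₂ (inj₁ (refl , refl))) with z Fin.≟ x
...   | yes refl = b (trans (sym T _ _) xy)
...   | no z≢x   = a (anti z z≢c z≢x z≢d)
semiadjacent-apart T (inj₂ (inj₂ (v , x , y , _ , _ , _ , _ , _ , only , anti , xy , _))) {z = z} c≢d s z≢c z≢d a b
    | inj₂ (inj₂ (inj₂ (refl , refl))) with z Fin.≟ x
...   | yes refl = a (trans (sym T _ _) xy)
...   | no z≢x   = b (anti z z≢d z≢x z≢c)

-- The two conclusions, by type of switchable component.

module EvenPairs (T : Trigraph) {a b : ℕ} (e : V T → Fin a × Fin b) (e-injective : Injective _≡_ _≡_ e)
  (adj⇔ : ∀ u v → u ≢ v → Adj T u v ⇔ (proj₁ (e u) ≡ proj₁ (e v) ⊎ proj₂ (e u) ≡ proj₂ (e v)))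
  (component : NoSwitchable T ⊎ SmallComponent T ⊎ LightComponent T) (¬prism : ¬ ContainsOddPrism T) where

  open LineGraph T e e-injective adj⇔
  open InducedPaths (λ {c} {d} {z} → semiadjacent-apart T component {c} {d} {z})
  open Bipartite _≟_ E E-sym side E-side
  open ThetaFree (noTheta ¬prism)
  open Decidability T

  edge-of : ∀ t → E (L t) (R t)
  edge-of t = t , inj₁ (refl , refl)

  apart-L : ∀ {t t′} → t ≢ t′ → StronglyAnti T t t′ → L t ≢ L t′
  apart-L ne anti eq = common-end ne (inj₁ refl) (inj₁ eq) anti

  apart-R : ∀ {t t′} → t ≢ t′ → StronglyAnti T t t′ → R t ≢ R t′
  apart-R ne anti eq = common-end ne (inj₂ refl) (inj₂ eq) anti

  module Unrestricted {A : V T → Set} (noPair : ∀ {t t′} → A t → A t′ → ¬ IsEvenPair T t t′) (A-all : ∀ t → A t) where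

    open NoGoodPair (λ _ → ⊤) (noGoodPair {A} {λ _ → ⊤} noPair (λ {t} _ _ _ → A-all t))

    -- With `Av` true everywhere, `avCycle` excludes all cycles and the side conditions of
    -- `acyclic-good` hold vacuously.
    noAntiPair : ∀ {t t′} → t ≢ t′ → ¬ StronglyAnti T t t′
    noAntiPair {t} {t′} ne anti =
      acyclic-good (λ w n len → avCycle w n len (λ _ → tt)) (λ _ → yes tt)
        (edge-of t) (edge-of t′) refl (apart-L ne anti) (apart-R ne anti) tt tt tt tt
        (λ _ _ _ ¬av _ → ¬av tt) (λ _ _ _ ¬av _ → ¬av tt)

  complete-or-evenPair : Complete T ⊎ HasEvenPair T
  complete-or-evenPair with hasEvenPair?
  ... | yes pair = inj₂ pair
  ... | no ¬pair = inj₁ λ u v → Unrestricted.noAntiPair {λ _ → ⊤} (λ _ _ pair → ¬pair (_ , _ , pair)) (λ _ → tt)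

  module _ (¬goal : ¬ Σ (V T) λ u → Σ (V T) λ v → IsEvenPair T u v × ¬ InD T u × ¬ InD T v) where

    private
      noPair : ∀ {t t′} → ¬ InD T t → ¬ InD T t′ → ¬ IsEvenPair T t t′
      noPair ¬d ¬d′ pair = ¬goal (_ , _ , pair , ¬d , ¬d′)

      end-or-adj : ∀ {t t′ z} → End t z → End t′ z → t ≡ t′ ⊎ Adj T t t′
      end-or-adj {t} {t′} e₁ e₂ with t Fin.≟ t′
      ... | yes eq = inj₁ eq
      ... | no ne  = inj₂ (common-end ne e₁ e₂)

    none-case : NoSwitchable T → Favorable T → ⊥
    none-case none (_ , (t , t′ , ne , anti , _) , _) =
      Unrestricted.noAntiPair noPair (λ t (w , w≢t , s) → none t w (λ eq → w≢t (≡-sym eq)) s) ne anti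

    module Small {x y : V T} (x≢y : x ≢ y) (sxy : Semiadj T x y) (only : OnlyEdge T x y)
      (apart : ∀ z → ¬ (InN T x z × InN T y z)) where

      -- Let `w` be the common end of `x` and `y`, and `p` the other end of `x`. A vertex outside
      -- `D` and the neighbourhood of `x` is an edge that misses `w` and `p`, so two antiadjacent
      -- ones contradict `degree-two-good`.
      restClique : RestClique T x
      restClique = case share x≢y (λ eq → case trans (≡-sym sxy) eq of λ ()) of λ (w , wx , wy) → withCentre wx wy
        where
        x∈D : InD T x
        x∈D = y , (λ eq → x≢y (≡-sym eq)) , sxy
        y∈D : InD T y
        y∈D = x , x≢y , trans (sym T y x) sxy
        withCentre : ∀ {w} → End x w → End y w → RestClique T x
        withCentre {w} wx wy t t′ (¬dt , ¬nt) (¬dt′ , ¬nt′) ne anti =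
          degree-two-good (edge-of t) (edge-of t′) refl (apart-L ne anti) (apart-R ne anti)
            (off ¬dt ¬nt (inj₁ refl) wx) (off ¬dt ¬nt (inj₂ refl) wx) (off ¬dt′ ¬nt′ (inj₁ refl) wx) (off ¬dt′ ¬nt′ (inj₂ refl) wx)
            (off ¬dt ¬nt (inj₁ refl) px) (off ¬dt ¬nt (inj₂ refl) px) (off ¬dt′ ¬nt′ (inj₁ refl) px) (off ¬dt′ ¬nt′ (inj₂ refl) px)
          where
          p q : W
          p = proj₁ (other-end wx)
          q = proj₁ (other-end wy)
          xwp : Joins x w p
          xwp = proj₂ (other-end wx)
          ywq : Joins y w q
          ywq = proj₂ (other-end wy)
          px : End x p
          px = proj₂ (joins-end xwp)
          off : ∀ {t z z′} → ¬ InD T t → ¬ InN T x t → End t z → End x z′ → z ≢ z′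
          off ¬d ¬n e₁ e₂ refl with end-or-adj e₂ e₁
          ... | inj₁ refl = ¬d x∈D
          ... | inj₂ adj  = ¬n ((λ { refl → ¬d x∈D }) , adj)
          -- A third edge at `w` would be a common neighbour of `x` and `y`.
          neighbours : ∀ {n} → E w n → n ≡ p ⊎ n ≡ q
          neighbours {n} (t , j) with t Fin.≟ x | t Fin.≟ y
          ... | yes refl | _        = inj₁ (joins-functional j xwp)
          ... | no _     | yes refl = inj₂ (joins-functional j ywq)
          ... | no t≢x   | no t≢y   = ⊥-elim (apart t ((t≢x , common-end (λ eq → t≢x (≡-sym eq)) wx tw)
                                                      , (t≢y , common-end (λ eq → t≢y (≡-sym eq)) wy tw)))
            where tw = proj₁ (joins-end j)
          ¬inD : ∀ {t u v} → Joins t u v → u ≢ w → v ≢ w → ¬ InD T t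
          ¬inD {t} j u≢w v≢w (d , d≢t , s) with only t d (λ eq → d≢t (≡-sym eq)) s
          ... | inj₁ (refl , _) = [ (λ eq → u≢w (≡-sym eq)) , (λ eq → v≢w (≡-sym eq)) ]′ (end-cases j wx)
          ... | inj₂ (refl , _) = [ (λ eq → u≢w (≡-sym eq)) , (λ eq → v≢w (≡-sym eq)) ]′ (end-cases j wy)
          open NoGoodPair (_≢ w) (noGoodPair noPair ¬inD)
          open DegreeTwoVertex (x , xwp) (y , ywq) (λ eq → x≢y (joins-injective xwp (subst (Joins y w) (≡-sym eq) ywq)))
            neighbours id id

    small-case : SmallComponent T → Favorable T → ⊥
    small-case (x , y , x≢y , sxy , only , apart) (_ , _ , fav) with fav x y x≢y sxy only
    ... | inj₁ ¬clique = ¬clique (Small.restClique x≢y sxy only apart)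
    -- The hypotheses on `x` and `y` are symmetric, so their roles are exchanged.
    ... | inj₂ ¬clique = ¬clique (Small.restClique (λ eq → x≢y (≡-sym eq)) (trans (sym T y x) sxy)
            (λ u w ne s → ⊎-swap (only u w ne s)) (λ z n → apart z (swap n)))

    light-case : LightComponent T → Favorable T → ⊥
    light-case (v , x , y , v≢x , v≢y , x≢y , svx , svy , only , anti , xy , common) (_ , (t , t′ , ne , tt′ , ¬dt , ¬dt′) , _) =
      case share v≢x (semi⇒adj svx) of λ (q , vq , xq) → case share v≢y (semi⇒adj svy) of λ (r , vr , yr) → withCentre vq xq vr yr
      where
      semi⇒adj : ∀ {u w} → Semiadj T u w → Adj T u w
      semi⇒adj s eq = case trans (≡-sym s) eq of λ ()
      v∈D : InD T v
      v∈D = x , (λ eq → v≢x (≡-sym eq)) , svx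
      x∈D : InD T x
      x∈D = v , v≢x , trans (sym T x v) svx
      y∈D : InD T y
      y∈D = v , v≢y , trans (sym T y v) svy
      -- In the bipartite graph `x`, `v`, `y` are the edges `pq`, `qr`, `rs` of a path. An edge at
      -- `q` or `r` equals `v` or is adjacent to it, so `q` and `r` have degree two.
      withCentre : ∀ {q r} → End v q → End x q → End v r → End y r → ⊥
      withCentre {q} {r} vq xq vr yr =
        degree-two-edge-good (edge-of t) (edge-of t′) refl (apart-L ne tt′) (apart-R ne tt′)
          (off ¬dt (inj₁ refl)) (off ¬dt (inj₂ refl)) (off ¬dt′ (inj₁ refl)) (off ¬dt′ (inj₂ refl))
        where
        ¬common-xy : ∀ {z} → End x z → ¬ End y z
        ¬common-xy xz yz = common-end x≢y xz yz xy
        p s : W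
        p = proj₁ (other-end xq)
        s = proj₁ (other-end yr)
        xqp : Joins x q p
        xqp = proj₂ (other-end xq)
        yrs : Joins y r s
        yrs = proj₂ (other-end yr)
        vqr : Joins v q r
        vqr = joins-ends vq vr λ { refl → ¬common-xy xq yr }
        which : ∀ {t z} → End v z → End t z → t ≡ v ⊎ t ≡ x ⊎ t ≡ y
        which {t} vz tz with t Fin.≟ v | t Fin.≟ x | t Fin.≟ y
        ... | yes eq | _      | _      = inj₁ eq
        ... | no _   | yes eq | _      = inj₂ (inj₁ eq)
        ... | no _   | no _   | yes eq = inj₂ (inj₂ eq)
        ... | no t≢v | no t≢x | no t≢y = ⊥-elim (common-end (λ eq → t≢v (≡-sym eq)) vz tz (anti t t≢v t≢x t≢y))
        off : ∀ {t z} → ¬ InD T t → End t z → z ≢ q × z ≢ r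
        off {t} {z} ¬d tz = (λ { refl → noEnd vq }) , (λ { refl → noEnd vr })
          where
          noEnd : ¬ End v z
          noEnd vz with which vz tz
          ... | inj₁ refl        = ¬d v∈D
          ... | inj₂ (inj₁ refl) = ¬d x∈D
          ... | inj₂ (inj₂ refl) = ¬d y∈D
        neighbours-q : ∀ {n} → E q n → n ≡ p ⊎ n ≡ r
        neighbours-q (_ , j) with which vq (proj₁ (joins-end j))
        ... | inj₁ refl        = inj₂ (joins-functional j vqr)
        ... | inj₂ (inj₁ refl) = inj₁ (joins-functional j xqp)
        ... | inj₂ (inj₂ refl) = ⊥-elim (¬common-xy xq (proj₁ (joins-end j)))
        neighbours-r : ∀ {n} → E r n → n ≡ q ⊎ n ≡ s
        neighbours-r (_ , j) with which vr (proj₁ (joins-end j))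
        ... | inj₁ refl        = inj₁ (joins-functional j (joins-sym vqr))
        ... | inj₂ (inj₁ refl) = ⊥-elim (¬common-xy (proj₁ (joins-end j)) yr)
        ... | inj₂ (inj₂ refl) = inj₂ (joins-functional j yrs)
        px : End x p
        px = proj₂ (joins-end xqp)
        sy : End y s
        sy = proj₂ (joins-end yrs)
        -- An edge `ps` would be a common neighbour of `x` and `y`, hence equal to `v`; but `p` is
        -- not an end of `v`.
        ¬ps : ¬ E p s
        ¬ps (t , j) with t Fin.≟ x | t Fin.≟ y
        ... | yes refl | _        = ¬common-xy (proj₂ (joins-end j)) sy
        ... | no _     | yes refl = ¬common-xy px (proj₁ (joins-end j))
        ... | no t≢x   | no t≢y
          with to (common t) ( (t≢x , common-end (λ eq → t≢x (≡-sym eq)) px (proj₁ (joins-end j)))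
                             , (t≢y , common-end (λ eq → t≢y (≡-sym eq)) sy (proj₂ (joins-end j))))
        ...   | refl with end-cases vqr (proj₁ (joins-end j))
        ...     | inj₁ eq = opposite (x , xqp) (cong side (≡-sym eq))
        ...     | inj₂ eq = ¬common-xy px (subst (End y) (≡-sym eq) yr)
        ¬inD : ∀ {t u w} → Joins t u w → u ≢ q × u ≢ r → w ≢ q × w ≢ r → ¬ InD T t
        ¬inD {t} j (u≢q , u≢r) (w≢q , w≢r) (d , d≢t , sm) with only t d (λ eq → d≢t (≡-sym eq)) sm
        ... | inj₁ (refl , _)               = [ (λ eq → u≢q (≡-sym eq)) , (λ eq → w≢q (≡-sym eq)) ]′ (end-cases j vq)
        ... | inj₂ (inj₁ (refl , _))        = [ (λ eq → u≢q (≡-sym eq)) , (λ eq → w≢q (≡-sym eq)) ]′ (end-cases j xq)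
        ... | inj₂ (inj₂ (inj₁ (refl , _))) = [ (λ eq → u≢q (≡-sym eq)) , (λ eq → w≢q (≡-sym eq)) ]′ (end-cases j vq)
        ... | inj₂ (inj₂ (inj₂ (refl , _))) = [ (λ eq → u≢r (≡-sym eq)) , (λ eq → w≢r (≡-sym eq)) ]′ (end-cases j yr)
        open NoGoodPair (λ z → z ≢ q × z ≢ r) (noGoodPair noPair ¬inD)
        open DegreeTwoEdge (x , xqp) (v , vqr) (y , yrs) neighbours-q neighbours-r ¬ps _,_ id

  disjointEvenPair : Favorable T → Σ (V T) λ u → Σ (V T) λ v → IsEvenPair T u v × ¬ InD T u × ¬ InD T v
  disjointEvenPair fav = decidable-stable hasDisjointEvenPair? λ ¬goal →
    [ (λ none → none-case ¬goal none fav)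
    , [ (λ small → small-case ¬goal small fav) , (λ light → light-case ¬goal light fav) ]′ ]′ component

theorem4p5 : (T : Trigraph) → IsLineTrigraph T → InF T → ¬ ContainsOddPrism T →
    (Complete T ⊎ HasEvenPair T)
    × (Favorable T → Σ (V T) λ u → Σ (V T) λ v → IsEvenPair T u v × ¬ InD T u × ¬ InD T v)
theorem4p5 T ((_ , _ , e , e-injective , adj⇔) , _) (_ , component) ¬prism = complete-or-evenPair , disjointEvenPair
  where open EvenPairs T e e-injective adj⇔ component ¬prism
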